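{- Graph Isomorphism is $\mathsf{GI}$-complete for Thickness-$k$ (that is, when restricted to the class Thickness-$k$ of bounded thickness graphs).
   Context: A graph $G$ is said to have thickness at most $k$ if $E(G)$ can be partitioned into at most $k$ subsets, each of which forms a planar subgraph of $G$. The class name Thickness-$k$ means bounded thickness graphs, with $k$ a constant (in the same way that the class of partial $k$-trees is also known as the class of bounded treewidth graphs). Graph Isomorphism is the following decision problem: given two graphs $G$ and $H$, decide whether $G$ and $H$ are isomorphic, i.e., whether there exists a bijection of the vertex sets that preserves adjacencies. A problem is $\mathsf{GI}$-complete if it is equivalent in complexity to general Graph Isomorphism (Graph Isomorphism with no restriction on the input graphs). -}

module Defs where

open import Data.Bool using (Bool; true; false)
open import Data.Empty using (⊥)
open import Data.Fin using (Fin; _<_)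
open import Data.List using (List; []; _∷_; _++_; [_]; length; replicate; concatMap; map; allFin)
open import Data.Maybe using (Maybe; just; nothing)
open import Data.Nat as ℕ using (ℕ; suc)
open import Data.Product using (Σ; ∃; ∃-syntax; ∃!; _×_; _,_; proj₁)
open import Data.Rational as ℚ using (ℚ; 0ℚ; 1ℚ)
open import Data.Sum using (_⊎_)
open import Data.Unit using (⊤)
open import Data.Vec as Vec using (Vec)
open import Function.Bundles using (_⤖_; _⇔_; Bijection)
open import Relation.Binary.PropositionalEquality using (_≡_; _≢_)

record Graph (n : ℕ) : Set where
  field
    adj    : Fin n → Fin n → Bool
    sym    : ∀ u v → adj u v ≡ adj v u
    irrefl : ∀ u → adj u u ≡ false

  Adj : Fin n → Fin n → Set
  Adj u v = adj u v ≡ true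

open Graph public using (adj; Adj)

_≅_ : ∀ {m n} → Graph m → Graph n → Set
_≅_ {m} {n} G H =
  Σ (Fin m ⤖ Fin n) λ φ → let open Bijection φ in
    ∀ u v → Adj G u v ⇔ Adj H (to u) (to v)

-- Edges are drawn as simple polygonal arcs.  Rational coordinates lose
-- nothing: two segments with rational endpoints that meet in ℝ² already
-- meet in a rational point, and a polygonal drawing over ℝ can be perturbed
-- to a rational one.

Point : Set
Point = ℚ × ℚ

OnSegment : Point → Point → Point → Set
OnSegment (x , y) (a , b) (c , d) =
  ∃[ t ] 0ℚ ℚ.≤ t × t ℚ.≤ 1ℚ
       × x ≡ a ℚ.+ t ℚ.* (c ℚ.- a)
       × y ≡ b ℚ.+ t ℚ.* (d ℚ.- b)

OnPath : Point → List Point → Set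
OnPath x []           = ⊥
OnPath x (p ∷ [])     = x ≡ p
OnPath x (p ∷ q ∷ ps) = OnSegment x p q ⊎ OnPath x (q ∷ ps)

Simple : List Point → Set
Simple []           = ⊤
Simple (p ∷ [])     = ⊤
Simple (p ∷ q ∷ ps) =
    p ≢ q
  × (∀ x → OnSegment x p q → OnPath x (q ∷ ps) → x ≡ q)
  × Simple (q ∷ ps)

-- The edge {u , v} is represented by its orientation with u < v; bend points
-- of other pairs are irrelevant.
record PlaneDrawing {n : ℕ} (G : Graph n) : Set where
  field
    pos   : Fin n → Point
    bends : Fin n → Fin n → List Point

  Edge : Fin n → Fin n → Set
  Edge u v = u < v × Adj G u v

  arc : Fin n → Fin n → List Point
  arc u v = pos u ∷ bends u v ++ [ pos v ]

  field
    pos-injective : ∀ {u v} → pos u ≡ pos v → u ≡ v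
    arc-simple    : ∀ {u v} → Edge u v → Simple (arc u v)
    arc-vertices  : ∀ {u v w} → Edge u v → OnPath (pos w) (arc u v) →
                    w ≡ u ⊎ w ≡ v
    arc-crossings : ∀ {u v u′ v′ x} → Edge u v → Edge u′ v′ →
                    (u , v) ≢ (u′ , v′) →
                    OnPath x (arc u v) → OnPath x (arc u′ v′) →
                    ∃[ w ] x ≡ pos w × (w ≡ u ⊎ w ≡ v) × (w ≡ u′ ⊎ w ≡ v′)

Planar : ∀ {n} → Graph n → Set
Planar = PlaneDrawing

-- Parts may be empty, so k parts means at most k nonempty ones.
record Thickness≤ (k : ℕ) {n : ℕ} (G : Graph n) : Set where
  field
    part        : Fin k → Graph n
    part-planar : ∀ i → Planar (part i)
    part-sub    : ∀ i u v → Adj (part i) u v → Adj G u v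
    part-cover  : ∀ u v → Adj G u v → ∃! _≡_ λ i → Adj (part i) u v

Symbol : Set
Symbol = Maybe Bool

pattern blank = nothing

data Move : Set where
  left stay right : Move

-- A two-way infinite tape; `before` lists the cells to the left of the head,
-- nearest first, and all cells not listed are blank.
record Tape : Set where
  constructor tape
  field
    before : List Symbol
    scan   : Symbol
    after  : List Symbol

open Tape public

fromCells : List Symbol → Tape
fromCells []       = tape [] blank []
fromCells (s ∷ ss) = tape [] s ss

move : Move → Tape → Tape
move left  (tape []       s rs)       = tape [] blank (s ∷ rs)
move left  (tape (l ∷ ls) s rs)       = tape ls l (s ∷ rs)
move stay  t                          = t
move right (tape ls       s [])       = tape (s ∷ ls) blank []
move right (tape ls       s (r ∷ rs)) = tape (s ∷ ls) r rs

act : Symbol × Move → Tape → Tape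
act (s , m) (tape ls _ rs) = move m (tape ls s rs)

record TM : Set where
  field
    workTapes : ℕ
    states    : ℕ
    start     : Fin states

  tapes : ℕ
  tapes = suc workTapes

  -- The machine halts where δ is `nothing`.
  field
    δ : Fin states → Vec Symbol tapes →
        Maybe (Fin states × Vec (Symbol × Move) tapes)

  Config : Set
  Config = Fin states × Vec Tape tapes

  step : Config → Maybe Config
  step (q , ts) with δ q (Vec.map scan ts)
  ... | nothing         = nothing
  ... | just (q′ , ops) = just (q′ , Vec.zipWith act ops ts)

  data _⇓[_]_ : Config → ℕ → Config → Set where
    halt : ∀ {c} → step c ≡ nothing → c ⇓[ 0 ] c
    next : ∀ {c c′ d t} → step c ≡ just c′ → c′ ⇓[ t ] d → c ⇓[ suc t ] d

  initial : List Bool → Config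
  initial w =
    start , fromCells (map just w) Vec.∷ Vec.replicate workTapes (fromCells [])

  -- The output stands on the first tape, from the head up to the first blank.
  output : Config → List Bool
  output (_ , t Vec.∷ _) = bits (scan t ∷ after t)
    where
    bits : List Symbol → List Bool
    bits []           = []
    bits (blank ∷ _)  = []
    bits (just b ∷ s) = b ∷ bits s

  ComputesIn : ℕ → List Bool → List Bool → Set
  ComputesIn b w w′ =
    ∃[ t ] ∃[ c ] t ℕ.≤ b × initial w ⇓[ t ] c × output c ≡ w′

record Problem : Set₁ where
  field
    Instance : Set
    encode   : Instance → List Bool
    Yes      : Instance → Set

open Problem public

-- Every polynomial in n is bounded by n ^ d + d for some d.
PolyTime : (A B : Problem) → (Instance A → Instance B) → Set
PolyTime A B f =
  ∃[ M ] ∃[ d ] ∀ x →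
    let w = encode A x in
    TM.ComputesIn M (length w ℕ.^ d ℕ.+ d) w (encode B (f x))

record _≤ₚ_ (A B : Problem) : Set where
  field
    reduce   : Instance A → Instance B
    polyTime : PolyTime A B reduce
    correct  : ∀ x → Yes A x ⇔ Yes B (reduce x)

-- A problem restricted to a class of instances: the membership proof is not
-- part of the encoded input, so an algorithm need not recognise the class.
restrict : (A : Problem) → (Instance A → Set) → Problem
restrict A C = record
  { Instance = Σ (Instance A) C
  ; encode   = λ x → encode A (proj₁ x)
  ; Yes      = λ x → Yes A (proj₁ x)
  }

-- The order in unary, a terminating 0, then the adjacency matrix by rows.
encodeGraph : ∀ {n} → Graph n → List Bool
encodeGraph {n} G =
  replicate n true ++ false ∷ concatMap (λ u → map (adj G u) (allFin n)) (allFin n)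

GI : Problem
GI = record
  { Instance = ∃ Graph × ∃ Graph
  ; encode   = λ { ((_ , G) , (_ , H)) → encodeGraph G ++ encodeGraph H }
  ; Yes      = λ { ((_ , G) , (_ , H)) → G ≅ H }
  }

GIOn : (∀ {n} → Graph n → Set) → Problem
GIOn C = restrict GI λ { ((_ , G) , (_ , H)) → C G × C H }

GI-complete : Problem → Set
GI-complete A = A ≤ₚ GI × GI ≤ₚ A

{-# OPTIONS --safe #-}
module Submission where

-- A graph G on n vertices is sent to the graph on n (n + 1) vertices in which
-- every vertex u becomes the hub of a star with n leaves (u , a), and the
-- leaves (u , a) and (a , u) are joined whenever u and a are adjacent, so that
-- edges become paths of length three.  The stars and the matching are planar,
-- hence the new graph has thickness two.  The leaf (u , u) stays pendant, which
-- makes the hubs recognisable and G recoverable.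
--
-- The adjacency matrix of the new graph is printed by four nested loops over
-- unary counters.  Equality of two loop variables x and y is tested on a tape
-- with a single mark whose head follows y − x, and since the entries of the
-- matrix of G are needed in the order in which they are stored, one pass over
-- the input suffices.

-- A leaf is attached for every pair (u , a), adjacent or not, and also for u = a. The order n (n +
-- 1) and the numbering of the vertices then depend on n alone, so the header can be printed before
-- any entry of the matrix is read, and the entry of G at (u , a) decides exactly one bit of the
-- output, in the row of the leaf that faces a from u. Adding vertices only for the edges present
-- would make every index depend on the earlier edges.
--
-- Since polynomial time refers to concrete machines, most of the work is a small language of
-- programs with rules that track tape contents and running time together. The loops leave their
-- heads where they found them, which makes them nest.
--
-- Hubs are recognised by a purely relational property, so every isomorphism of expanded graphs
-- respects it. This fails for n = 1, where the expanded graph is a single edge whose ends can be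
-- exchanged; orders below two are compared by hand.
--
-- In the other direction membership proofs are not encoded, so the reduction leaves the input as it
-- stands.

open import Defs
open import Data.Bool using (Bool; true; false; if_then_else_; _∧_; _∨_; _xor_)
open import Data.Bool.Properties using (∨-comm; xor-comm; T-≡; ∧-conicalˡ; ∧-conicalʳ)
open import Data.Empty using (⊥; ⊥-elim)
open import Data.Fin as Fin using
  (Fin; zero; suc; toℕ; fromℕ; inject₁; splitAt; _↑ˡ_; _↑ʳ_; #_; _≟_; combine; remQuot)
open import Data.Fin.Properties using
  ( splitAt-↑ˡ; splitAt-↑ʳ; toℕ<n; toℕ-fromℕ; toℕ-inject₁; toℕ-injective; suc-injective
  ; combine-injective; combine-monoˡ-<; remQuot-combine; combine-remQuot
  ; <-cmp; <-irrefl; <-asym; _<?_)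
open import Data.Integer as ℤ using (ℤ; +_; -[1+_]; 0ℤ; 1ℤ; -1ℤ)
import Data.Integer.Properties as ℤ
open import Data.Integer.Tactic.RingSolver using (solve-∀)
open import Data.List as List using
  (List; []; _∷_; _++_; [_]; _ʳ++_; concat; concatMap; map; tabulate; replicate; allFin; length; reverse)
open import Data.List.Properties using
  ( ∷-injectiveˡ; ∷-injectiveʳ; ++-assoc; ++-identityʳ; ++-ʳ++; ʳ++-defn; map-++; map-tabulate
  ; length-++; length-replicate; length-reverse; reverse-map; reverse-involutive)
open import Data.Maybe using (Maybe; just; nothing; maybe′; is-just)
import Data.Nat as ℕ
import Data.Nat.Properties as ℕ
import Data.Nat.Tactic.RingSolver as ℕ-Solver
open import Data.Product using (∃-syntax; _×_; _,_; proj₁; proj₂; map₁)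
open import Data.Sum using (_⊎_; inj₁; inj₂; [_,_]′; swap) renaming (map to ⊎-map)
open import Data.Unit using (tt)
open import Data.Vec as Vec using (Vec; []; _∷_; lookup)
open import Data.Vec.Properties using (lookup-map; lookup-zipWith; lookup∘tabulate; lookup-replicate)
open import Function using (_∘_; case_of_; id)
open import Function.Bundles using (_⇔_; mk⇔; Equivalence; mk↔ₛ′; Inverse)
open import Function.Properties.Bijection using (⤖⇒↔)
open import Function.Properties.Inverse using (↔⇒⤖)
open import Relation.Binary using (tri<; tri≈; tri>)
open import Relation.Binary.PropositionalEquality hiding ([_])
open import Relation.Nullary using (yes; no; does; ¬_)
open import Relation.Nullary.Decidable using (dec-true; dec-false)

-- Straight-line drawings of star forests

module Planarity where

  open import Data.Nat using (ℕ; zero; suc; z≤n; s≤s)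
  open import Data.Rational as ℚ using (ℚ; 0ℚ; 1ℚ; _+_; _*_; _-_; -_; _≤_)
  import Data.Rational.Properties as ℚ
  open import Data.Rational.Solver using (module +-*-Solver)
  open +-*-Solver using (solve; _:+_; _:*_; _:-_; _:=_; con)

  ι : ℕ → ℚ
  ι zero    = 0ℚ
  ι (suc n) = 1ℚ + ι n

  0≤1 : 0ℚ ≤ 1ℚ
  0≤1 = ℚ.nonNegative⁻¹ 1ℚ

  0<1 : 0ℚ ℚ.< 1ℚ
  0<1 = ℚ.positive⁻¹ 1ℚ

  0≤ι : ∀ n → 0ℚ ≤ ι n
  0≤ι zero    = ℚ.≤-refl
  0≤ι (suc n) = ℚ.+-mono-≤ 0≤1 (0≤ι n)

  ι-mono-≤ : ∀ {m n} → m ℕ.≤ n → ι m ≤ ι n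
  ι-mono-≤ {n = n} z≤n = 0≤ι n
  ι-mono-≤ (s≤s h) = ℚ.+-monoʳ-≤ 1ℚ (ι-mono-≤ h)

  ι-<-suc : ∀ n → ι n ℚ.< ι (suc n)
  ι-<-suc n = subst (ℚ._< ι (suc n)) (ℚ.+-identityˡ (ι n)) (ℚ.+-monoˡ-< (ι n) 0<1)

  ι-mono-< : ∀ {m n} → m ℕ.< n → ι m ℚ.< ι n
  ι-mono-< {m} h = ℚ.<-≤-trans (ι-<-suc m) (ι-mono-≤ h)

  ι-injective : ∀ {m n} → ι m ≡ ι n → m ≡ n
  ι-injective {m} {n} eq with ℕ.<-cmp m n
  ... | tri< h _ _ = ⊥-elim (ℚ.<-irrefl eq (ι-mono-< h))
  ... | tri≈ _ h _ = h
  ... | tri> _ _ h = ⊥-elim (ℚ.<-irrefl (sym eq) (ι-mono-< h))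

  0≤* : ∀ {p q} → 0ℚ ≤ p → 0ℚ ≤ q → 0ℚ ≤ p * q
  0≤* {p} {q} hp hq = subst (_≤ p * q) (ℚ.*-zeroʳ p)
    (ℚ.*-monoˡ-≤-nonNeg p {{ℚ.nonNegative hp}} hq)

  0≤-⇒≤ : ∀ {p q} → 0ℚ ≤ q - p → p ≤ q
  0≤-⇒≤ {p} {q} h = subst₂ _≤_ (ℚ.+-identityˡ p)
    (solve 2 (λ p q → q :- p :+ p := q) refl p q) (ℚ.+-monoˡ-≤ p h)

  ≤⇒0≤- : ∀ {p q} → p ≤ q → 0ℚ ≤ q - p
  ≤⇒0≤- {p} {q} h = subst (_≤ q - p) (ℚ.+-inverseʳ p) (ℚ.+-monoˡ-≤ (- p) h)

  -- The distance to `m` is the convex combination (1 - t)(m - a) + t (m - b) of nonnegative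
  -- numbers.
  between-≤ : ∀ {a b m t} → 0ℚ ≤ t → t ≤ 1ℚ → a ≤ m → b ≤ m → a + t * (b - a) ≤ m
  between-≤ {a} {b} {m} {t} 0≤t t≤1 a≤m b≤m = 0≤-⇒≤ (subst (0ℚ ≤_)
    (solve 4 (λ a b m t → (con 1ℚ :- t) :* (m :- a) :+ t :* (m :- b) := m :- (a :+ t :* (b :- a))) refl a b m t)
    (ℚ.+-mono-≤ (0≤* (≤⇒0≤- t≤1) (≤⇒0≤- a≤m)) (0≤* 0≤t (≤⇒0≤- b≤m))))

  between-≥ : ∀ {a b m t} → 0ℚ ≤ t → t ≤ 1ℚ → m ≤ a → m ≤ b → m ≤ a + t * (b - a)
  between-≥ {a} {b} {m} {t} 0≤t t≤1 m≤a m≤b = 0≤-⇒≤ (subst (0ℚ ≤_)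
    (solve 4 (λ a b m t → (con 1ℚ :- t) :* (a :- m) :+ t :* (b :- m) := (a :+ t :* (b :- a)) :- m) refl a b m t)
    (ℚ.+-mono-≤ (0≤* (≤⇒0≤- t≤1) (≤⇒0≤- m≤a)) (0≤* 0≤t (≤⇒0≤- m≤b))))

  -- Stars are drawn between the lines y = 0 and y = 1, in disjoint vertical strips:
  -- x has abscissa N · anchor x + x.
  module StarForest {N : ℕ} (parent : Fin N → Fin N) (leaf : Fin N → Bool)
    (parent-root : ∀ x → leaf x ≡ true → leaf (parent x) ≡ false) where

    Hangs : Fin N → Fin N → Set
    Hangs x y = leaf x ≡ true × parent x ≡ y

    hangs : Fin N → Fin N → Bool
    hangs x y = leaf x ∧ does (parent x ≟ y)

    hangs⇒Hangs : ∀ x y → hangs x y ≡ true → Hangs x y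
    hangs⇒Hangs x y h with leaf x | parent x ≟ y
    ... | true | yes eq = refl , eq

    Hangs⇒hangs : ∀ {x y} → Hangs x y → hangs x y ≡ true
    Hangs⇒hangs {x} (l , refl) rewrite l = dec-true (parent x ≟ parent x) refl

    Hangs-irrefl : ∀ {x} → ¬ Hangs x x
    Hangs-irrefl {x} (l , p) = case trans (sym l) (trans (cong leaf (sym p)) (parent-root x l)) of λ ()

    hangs-irrefl : ∀ x → hangs x x ≡ false
    hangs-irrefl x with hangs x x in eq
    ... | true  = ⊥-elim (Hangs-irrefl (hangs⇒Hangs x x eq))
    ... | false = refl

    forest : Graph N
    forest = record
      { adj    = λ x y → hangs x y ∨ hangs y x
      ; sym    = λ x y → ∨-comm (hangs x y) (hangs y x)
      ; irrefl = λ x → cong (λ b → b ∨ b) (hangs-irrefl x)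
      }

    adj⇒Hangs : ∀ x y → Adj forest x y → Hangs x y ⊎ Hangs y x
    adj⇒Hangs x y h with hangs x y in eq
    ... | true  = inj₁ (hangs⇒Hangs x y eq)
    ... | false = inj₂ (hangs⇒Hangs y x h)

    Hangs⇒adj : ∀ {x y} → Hangs x y ⊎ Hangs y x → Adj forest x y
    Hangs⇒adj         (inj₁ h) rewrite Hangs⇒hangs h = refl
    Hangs⇒adj {x} {y} (inj₂ h) rewrite Hangs⇒hangs h = ∨-comm (hangs x y) true

    anchor : Fin N → Fin N
    anchor x = if leaf x then parent x else x

    column : Fin N → ℕ
    column x = toℕ (combine (anchor x) x)

    X Y : Fin N → ℚ
    X x = ι (column x)
    Y x = if leaf x then 1ℚ else 0ℚ

    X-injective : ∀ {x y} → X x ≡ X y → x ≡ y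
    X-injective {x} {y} eq = proj₂ (combine-injective (anchor x) x (anchor y) y (toℕ-injective (ι-injective eq)))

    position : Fin N → Point
    position x = X x , Y x

    position-injective : ∀ {x y} → position x ≡ position y → x ≡ y
    position-injective eq = X-injective (cong proj₁ eq)

    module _ {l : Fin N} (l-leaf : leaf l ≡ true) where

      anchor-leaf : anchor l ≡ parent l
      anchor-leaf rewrite l-leaf = refl
      anchor-parent : anchor (parent l) ≡ parent l
      anchor-parent rewrite parent-root l l-leaf = refl
      Y-leaf : Y l ≡ 1ℚ
      Y-leaf rewrite l-leaf = refl
      Y-parent : Y (parent l) ≡ 0ℚ
      Y-parent rewrite parent-root l l-leaf = refl

    -- The height of a point is also its parameter on the segment from parent l to l.
    On : Fin N → Point → Set
    On l (x , t) = 0ℚ ≤ t × t ≤ 1ℚ × x ≡ X (parent l) + t * (X l - X (parent l))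

    -- Edges are drawn from the smaller index to the larger, and the leaf can be either end.
    data Ends (l u v : Fin N) : Set where
      up   : u ≡ parent l → v ≡ l → Ends l u v
      down : u ≡ l → v ≡ parent l → Ends l u v

    Ends-left : ∀ {l u v w} → Ends l u v → w ≡ parent l ⊎ w ≡ l → w ≡ u ⊎ w ≡ v
    Ends-left (up refl refl)   h = h
    Ends-left (down refl refl) h = swap h

    -- A leaf has a single edge and `u < v` fixes its orientation, so distinct edges have distinct
    -- leaves.
    Ends-unique : ∀ {l u v u′ v′} → u Fin.< v → u′ Fin.< v′ → Ends l u v → Ends l u′ v′ → (u , v) ≡ (u′ , v′)
    Ends-unique h h′ (up refl refl)   (up refl refl)   = refl
    Ends-unique h h′ (up refl refl)   (down refl refl) = ⊥-elim (<-asym h h′)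
    Ends-unique h h′ (down refl refl) (up refl refl)   = ⊥-elim (<-asym h h′)
    Ends-unique h h′ (down refl refl) (down refl refl) = refl

    arc-leaf : ∀ {u v} → Adj forest u v → ∃[ l ] leaf l ≡ true × Ends l u v
    arc-leaf {u} {v} h with adj⇒Hangs u v h
    ... | inj₁ (l , p) = u , l , down refl (sym p)
    ... | inj₂ (l , p) = v , l , up (sym p) refl

    segment : ∀ {l u v p} → leaf l ≡ true → Ends l u v → OnSegment p (position u) (position v) → On l p
    segment {l} {p = x , y} l-leaf (up refl refl) (t , 0≤t , t≤1 , px , py) =
      subst (λ y → On l (x , y)) (sym height) (0≤t , t≤1 , px)
      where
      height : y ≡ t
      height = trans py (trans (cong₂ (λ a b → a + t * (b - a)) (Y-parent l-leaf) (Y-leaf l-leaf))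
        (solve 1 (λ t → con 0ℚ :+ t :* (con 1ℚ :- con 0ℚ) := t) refl t))
    -- Drawn from the leaf downwards, the arc is at height 1 - t at parameter t.
    segment {l} {p = x , y} l-leaf (down refl refl) (t , 0≤t , t≤1 , px , py) =
      subst (λ y → On l (x , y)) (sym height)
        ( ≤⇒0≤- t≤1
        , 0≤-⇒≤ (subst (0ℚ ≤_) (solve 1 (λ t → t := con 1ℚ :- (con 1ℚ :- t)) refl t) 0≤t)
        , trans px (solve 3 (λ a b t → a :+ t :* (b :- a) := b :+ (con 1ℚ :- t) :* (a :- b)) refl
                     (X l) (X (parent l)) t))
      where
      height : y ≡ 1ℚ - t
      height = trans py (trans (cong₂ (λ a b → a + t * (b - a)) (Y-leaf l-leaf) (Y-parent l-leaf))
        (solve 1 (λ t → con 1ℚ :+ t :* (con 0ℚ :- con 1ℚ) := con 1ℚ :- t) refl t))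

    endpoint : ∀ p q → OnSegment q p q
    endpoint (a , b) (c , d) = 1ℚ , 0≤1 , ℚ.≤-refl , lem a c , lem b d
      where
      lem : ∀ a c → c ≡ a + 1ℚ * (c - a)
      lem = solve 2 (λ a c → c := a :+ con 1ℚ :* (c :- a)) refl

    on-arc : ∀ {l u v p} → leaf l ≡ true → Ends l u v →
             OnPath p (position u ∷ position v ∷ []) → On l p
    on-arc {p = p} l-leaf e (inj₁ h) = segment {p = p} l-leaf e h
    on-arc {u = u} {v} l-leaf e (inj₂ refl) =
      segment {p = position v} l-leaf e (endpoint (position u) (position v))

    at-bottom : ∀ {l x} → On l (x , 0ℚ) → x ≡ X (parent l)
    at-bottom {l} (_ , _ , eq) = trans eq
      (solve 2 (λ a b → a :+ con 0ℚ :* (b :- a) := a) refl (X (parent l)) (X l))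

    at-top : ∀ {l x} → On l (x , 1ℚ) → x ≡ X l
    at-top {l} (_ , _ , eq) = trans eq
      (solve 2 (λ a b → a :+ con 1ℚ :* (b :- a) := b) refl (X (parent l)) (X l))

    -- All vertices have height 0 or 1, and at these heights the segment has only its two ends.
    vertices-on : ∀ {l} w → On l (position w) → w ≡ parent l ⊎ w ≡ l
    vertices-on w h with leaf w in eq
    ... | true  = inj₂ (X-injective (trans (cong (λ b → ι (toℕ (combine (if b then parent w else w) w))) eq) (at-top h)))
    ... | false = inj₁ (X-injective (trans (cong (λ b → ι (toℕ (combine (if b then parent w else w) w))) eq) (at-bottom h)))

    -- All columns of the first star are at most `m` and those of the second at least `suc m`, so a
    -- vertical strip separates the segments.
    apart : ∀ {l l′ p} → leaf l ≡ true → leaf l′ ≡ true → parent l Fin.< parent l′ → On l p → On l′ p → ⊥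
    apart {l} {l′} {x , t} h h′ c<c′ (0≤t , t≤1 , eq) (_ , _ , eq′) =
      ℚ.<-irrefl refl (ℚ.≤-<-trans
        (subst (_≤ ι m) (sym eq) (between-≤ 0≤t t≤1 (ι-mono-≤ (ℕ.m≤m⊔n a b)) (ι-mono-≤ (ℕ.m≤n⊔m a b))))
        (ℚ.<-≤-trans (ι-<-suc m)
          (subst (ι (suc m) ≤_) (sym eq′) (between-≥ 0≤t t≤1
            (ι-mono-≤ (below anchor-c′))
            (ι-mono-≤ (below anchor-l′))))))
      where
      a = column (parent l)
      b = column l
      m = a ℕ.⊔ b
      anchor-c  = anchor-parent h
      anchor-l  = anchor-leaf h
      anchor-c′ = anchor-parent h′
      anchor-l′ = anchor-leaf h′
      left-of : ∀ {x y} → anchor x ≡ parent l → anchor y ≡ parent l′ → column x ℕ.< column y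
      left-of {x} {y} p q = combine-monoˡ-< x y (subst₂ Fin._<_ (sym p) (sym q) c<c′)
      below : ∀ {y} → anchor y ≡ parent l′ → suc m ℕ.≤ column y
      below {y} q = ℕ.⊔-lub (left-of anchor-c q) (left-of anchor-l q)

    -- Segments leaving a common hub diverge: above height 0 the abscissa determines the leaf.
    cancel : ∀ {a b c t} → 0ℚ ≤ t → t ≢ 0ℚ → a + t * (b - a) ≡ a + t * (c - a) → b ≡ c
    cancel {a} {b} {c} {t} 0≤t t≢0 eq = ℚ.≤-antisym (halve (ℚ.≤-reflexive tb≡tc)) (halve (ℚ.≤-reflexive (sym tb≡tc)))
      where
      halve : ∀ {p q} → t * p ≤ t * q → p ≤ q
      halve = ℚ.*-cancelˡ-≤-pos t {{ℚ.positive (ℚ.≰⇒> (λ t≤0 → t≢0 (ℚ.≤-antisym t≤0 0≤t)))}}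
      lem : ∀ b → a + t * (b - a) + (t * a - a) ≡ t * b
      lem b = solve 3 (λ a b t → a :+ t :* (b :- a) :+ (t :* a :- a) := t :* b) refl a b t
      tb≡tc : t * b ≡ t * c
      tb≡tc = trans (sym (lem b)) (trans (cong (_+ (t * a - a)) eq) (lem c))

    crossing : ∀ {l l′ p} → leaf l ≡ true → leaf l′ ≡ true → l ≢ l′ → On l p → On l′ p →
               ∃[ w ] p ≡ position w × w ≡ parent l × w ≡ parent l′
    crossing {l} {l′} {x , t} h h′ ne on on′ with <-cmp (parent l) (parent l′)
    ... | tri< c<c′ _ _ = ⊥-elim (apart h h′ c<c′ on on′)
    ... | tri> _ _ c′<c = ⊥-elim (apart h′ h c′<c on′ on)
    -- At height 0 both segments are at their common hub; higher up they would have to be the same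
    -- segment.
    ... | tri≈ _ c≡c′ _ with t ℚ.≟ 0ℚ
    ...   | yes refl = parent l , cong₂ _,_ (at-bottom on) (sym (Y-parent h)) , refl , c≡c′
    ...   | no t≢0   = ⊥-elim (ne (X-injective (cancel {X (parent l)} {X l} {X l′} (proj₁ on) t≢0 (trans (sym (proj₂ (proj₂ on)))
              (trans (proj₂ (proj₂ on′)) (cong (λ c → X c + t * (X l′ - X c)) (sym c≡c′)))))))

    forest-planar : Planar forest
    forest-planar = record
      { pos           = position
      ; bends         = λ _ _ → []
      ; pos-injective = position-injective
      ; arc-simple    = λ { (u<v , _) → (λ eq → <-irrefl (position-injective eq) u<v) , (λ _ _ eq → eq) , tt }
      ; arc-vertices  = λ { {w = w} (_ , e) on → let l , h , ends = arc-leaf e in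
                            Ends-left ends (vertices-on w (on-arc h ends on)) }
      ; arc-crossings = λ { (u<v , e) (u′<v′ , e′) ne on on′ →
          let l  , h  , ends  = arc-leaf e
              l′ , h′ , ends′ = arc-leaf e′
              w , p , q , q′  = crossing h h′
                (λ l≡l′ → ne (Ends-unique u<v u′<v′ ends (subst (λ l → Ends l _ _) (sym l≡l′) ends′)))
                (on-arc h ends on) (on-arc h′ ends′ on′)
          in w , p , Ends-left ends (inj₁ q) , Ends-left ends′ (inj₁ q′) }
      }

open import Data.Nat using (ℕ; zero; suc; _+_; _*_; _^_; _≤_; _<_; _<ᵇ_; z≤n; s≤s)
open import Data.Nat.Properties using
  ( ≤-refl; ≤-reflexive; ≤-trans; <ᵇ⇒<; m<n⇒m<1+n; m≤m+n; m≤n+m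
  ; +-assoc; +-comm; +-identityʳ; *-identityʳ; ^-identityʳ; +-mono-≤; *-mono-≤; *-monoˡ-≤
  ; ^-monoʳ-≤; ^-distribˡ-+-*)

-- Structured programs and their compilation to Turing machines

still : ∀ {n} → Vec Symbol n → Vec (Symbol × Move) n
still = Vec.map (_, stay)

perform-still : ∀ {n} (ts : Vec Tape n) → Vec.zipWith act (still (Vec.map scan ts)) ts ≡ ts
perform-still []       = refl
perform-still (t ∷ ts) = cong (t ∷_) (perform-still ts)

module Programs (k : ℕ) where

  Tapes Symbols Actions : Set
  Tapes   = Vec Tape (suc k)
  Symbols = Vec Symbol (suc k)
  Actions = Vec (Symbol × Move) (suc k)

  infixr 5 _⨾_

  data Prog : Set where
    op    : (Symbols → Actions) → Prog
    _⨾_   : Prog → Prog → Prog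
    while : (Symbols → Bool) → Prog → Prog

  scans : Tapes → Symbols
  scans = Vec.map scan

  perform : Actions → Tapes → Tapes
  perform = Vec.zipWith act

  size : Prog → ℕ
  size (op f)      = 1
  size (p ⨾ q)     = size p + size q
  size (while b p) = suc (size p)

  entry : ∀ p → Fin (size p)
  entry (op f)      = zero
  entry (p ⨾ q)     = entry p ↑ˡ size q
  entry (while b p) = zero

  after-first : ∀ p q → Maybe (Fin (size p)) → Maybe (Fin (size (p ⨾ q)))
  after-first p q = just ∘ maybe′ (_↑ˡ size q) (size p ↑ʳ entry q)

  after-second : ∀ p q → Maybe (Fin (size q)) → Maybe (Fin (size (p ⨾ q)))
  after-second p q = maybe′ (just ∘ (size p ↑ʳ_)) nothing

  after-body : ∀ b p → Maybe (Fin (size p)) → Maybe (Fin (size (while b p)))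
  after-body b p = just ∘ maybe′ suc zero

  -- The successor state `nothing` means that control leaves the program.
  next : ∀ p → Fin (size p) → Symbols → Maybe (Fin (size p)) × Actions
  next (op f)      s       ss = nothing , f ss
  next (p ⨾ q)     s       ss =
    [ (λ i → map₁ (after-first p q) (next p i ss))
    , (λ j → map₁ (after-second p q) (next q j ss))
    ]′ (splitAt (size p) s)
  next (while b p) zero    ss = (if b ss then just (suc (entry p)) else nothing) , still ss
  next (while b p) (suc s) ss = map₁ (after-body b p) (next p s ss)

  data Run (p : Prog) (s : Fin (size p)) (ts : Tapes) : ℕ → Tapes → Set where
    exit : ∀ {as} → next p s (scans ts) ≡ (nothing , as) →
           Run p s ts 1 (perform as ts)
    goto : ∀ {s′ as t ts′} → next p s (scans ts) ≡ (just s′ , as) →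
           Run p s′ (perform as ts) t ts′ → Run p s ts (suc t) ts′

  run-seqʳ : ∀ {p q s ts t ts′} → Run q s ts t ts′ → Run (p ⨾ q) (size p ↑ʳ s) ts t ts′
  run-seqʳ {p} {q} {s} {ts} (exit eq) = exit (trans
    (cong [ _ , _ ]′ (splitAt-↑ʳ (size p) (size q) s)) (cong (map₁ (after-second p q)) eq))
  run-seqʳ {p} {q} {s} {ts} (goto eq r) = goto (trans
    (cong [ _ , _ ]′ (splitAt-↑ʳ (size p) (size q) s)) (cong (map₁ (after-second p q)) eq)) (run-seqʳ r)

  run-seqˡ : ∀ {p q s ts t ts₁ t′ ts₂} → Run p s ts t ts₁ →
             Run q (entry q) ts₁ t′ ts₂ → Run (p ⨾ q) (s ↑ˡ size q) ts (t + t′) ts₂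
  run-seqˡ {p} {q} {s} (exit eq) r = goto (trans
    (cong [ _ , _ ]′ (splitAt-↑ˡ (size p) s (size q))) (cong (map₁ (after-first p q)) eq)) (run-seqʳ r)
  run-seqˡ {p} {q} {s} (goto eq r) r′ = goto (trans
    (cong [ _ , _ ]′ (splitAt-↑ˡ (size p) s (size q))) (cong (map₁ (after-first p q)) eq)) (run-seqˡ r r′)

  run-body : ∀ {b p s ts t ts₁ t′ ts₂} → Run p s ts t ts₁ →
             Run (while b p) zero ts₁ t′ ts₂ → Run (while b p) (suc s) ts (t + t′) ts₂
  run-body {b} {p} (exit eq)   r  = goto (cong (map₁ (after-body b p)) eq) r
  run-body {b} {p} (goto eq r) r′ = goto (cong (map₁ (after-body b p)) eq) (run-body r r′)

  Exec : Prog → Tapes → ℕ → Tapes → Set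
  Exec p ts b ts′ = ∃[ t ] t ≤ b × Run p (entry p) ts t ts′

  exec-op : ∀ {f ts} → Exec (op f) ts 1 (perform (f (scans ts)) ts)
  exec-op = 1 , ≤-refl , exit refl

  exec-seq : ∀ {p q ts b ts₁ c ts₂} → Exec p ts b ts₁ → Exec q ts₁ c ts₂ →
             Exec (p ⨾ q) ts (b + c) ts₂
  exec-seq (_ , l , r) (_ , l′ , r′) = _ , +-mono-≤ l l′ , run-seqˡ r r′

  -- The test is itself a machine step that writes back what it reads: hence the cost 1 and the
  -- transport along `perform-still`.
  exec-done : ∀ {b p ts} → b (scans ts) ≡ false → Exec (while b p) ts 1 ts
  exec-done {b} {p} {ts} eq = 1 , ≤-refl ,
    subst (Run _ _ ts 1) (perform-still ts)
      (exit (cong (λ x → (if x then _ else _) , _) eq))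

  exec-again : ∀ {b p ts c ts₁ d ts₂} → b (scans ts) ≡ true → Exec p ts c ts₁ →
               Exec (while b p) ts₁ d ts₂ → Exec (while b p) ts (suc (c + d)) ts₂
  exec-again {b} {p} {ts} eq (_ , l , r) (_ , l′ , r′) =
    _ , s≤s (+-mono-≤ l l′) ,
    goto (cong (λ x → (if x then _ else _) , _) eq)
      (run-body (subst (λ ts → Run _ _ ts _ _) (sym (perform-still ts)) r) r′)

  exec-weaken : ∀ {p ts b c ts′} → b ≤ c → Exec p ts b ts′ → Exec p ts c ts′
  exec-weaken b≤c (_ , l , r) = _ , ≤-trans l b≤c , r

  -- State `zero` is an added halting state, entered when control leaves the program.
  machine : Prog → TM
  machine p = record
    { workTapes = k
    ; states    = suc (size p)
    ; start     = suc (entry p)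
    ; δ         = λ { zero    ss → nothing
                    ; (suc s) ss → just (map₁ (maybe′ suc zero) (next p s ss)) }
    }

  run-machine : ∀ {p s ts t ts′} → Run p s ts t ts′ →
                TM._⇓[_]_ (machine p) (suc s , ts) t (zero , ts′)
  run-machine (exit eq)   = TM.next (cong (λ (s , as) → just (maybe′ suc zero s , perform as _)) eq) (TM.halt refl)
  run-machine (goto eq r) = TM.next (cong (λ (s , as) → just (maybe′ suc zero s , perform as _)) eq) (run-machine r)

-- Tapes carrying blocks of ones

nth : List Symbol → ℕ → Symbol
nth []       _       = blank
nth (s ∷ ss) zero    = s
nth (s ∷ ss) (suc i) = nth ss i

-- Blocks are specified by visible cells relative to the head, because head movements can add
-- explicit blanks to the lists of a tape.
read : Tape → ℤ → Symbol
read t (+ zero)  = scan t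
read t (+ suc i) = nth (after t) i
read t -[1+ i ]  = nth (before t) i

dir : Move → ℤ
dir left  = -1ℤ
dir stay  = 0ℤ
dir right = 1ℤ

read-move : ∀ d t y → read (move d t) y ≡ read t (y ℤ.+ dir d)
read-move stay  t y rewrite ℤ.+-identityʳ y = refl
read-move left  (tape []       s rs) (+ zero)     = refl
read-move left  (tape (l ∷ ls) s rs) (+ zero)     = refl
read-move left  (tape []       s rs) (+ suc zero) = refl
read-move left  (tape (l ∷ ls) s rs) (+ suc zero) = refl
read-move left  (tape []       s rs) (+ suc (suc i)) = refl
read-move left  (tape (l ∷ ls) s rs) (+ suc (suc i)) = refl
read-move left  (tape []       s rs) -[1+ i ]     = refl
read-move left  (tape (l ∷ ls) s rs) -[1+ i ] rewrite +-identityʳ i = refl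
read-move right (tape ls s [])       (+ i) rewrite +-comm i 1 = lem i
  where
  lem : ∀ i → read (tape (s ∷ ls) blank []) (+ i) ≡ blank
  lem zero    = refl
  lem (suc i) = refl
read-move right (tape ls s (r ∷ rs)) (+ i) rewrite +-comm i 1 = lem i
  where
  lem : ∀ i → read (tape (s ∷ ls) r rs) (+ i) ≡ nth (r ∷ rs) i
  lem zero    = refl
  lem (suc i) = refl
read-move right (tape ls s [])       -[1+ zero ]  = refl
read-move right (tape ls s [])       -[1+ suc i ] = refl
read-move right (tape ls s (r ∷ rs)) -[1+ zero ]  = refl
read-move right (tape ls s (r ∷ rs)) -[1+ suc i ] = refl

ones : ℕ → ℤ → Symbol
ones m (+ i)    = if i <ᵇ m then just true else blank
ones m -[1+ _ ] = blank

-- A block of m ones, the head standing z cells to the right of its first cell.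
Ones : ℕ → ℤ → Tape → Set
Ones m z t = ∀ y → read t y ≡ ones m (y ℤ.+ z)

ones-scan : ∀ {m z t} → Ones m z t → scan t ≡ ones m z
ones-scan {m} {z} h = trans (h 0ℤ) (cong (ones m) (ℤ.+-identityˡ z))

ones-move : ∀ {m z t} d → Ones m z t → Ones m (z ℤ.+ dir d) (move d t)
ones-move {m} {z} {t} d h y = trans (read-move d t y)
  (trans (h (y ℤ.+ dir d)) (cong (ones m) (lem y (dir d) z)))
  where
  lem : ∀ y d z → y ℤ.+ d ℤ.+ z ≡ y ℤ.+ (z ℤ.+ d)
  lem = solve-∀

ones-< : ∀ {m i} → i < m → ones m (+ i) ≡ just true
ones-< {suc m} {zero}  l       = refl
ones-< {suc m} {suc i} (s≤s l) = ones-< l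

ones-≡ : ∀ m → ones m (+ m) ≡ blank
ones-≡ zero    = refl
ones-≡ (suc m) = ones-≡ m

ones-suc : ∀ m x → x ≢ + m → ones m x ≡ ones (suc m) x
ones-suc m       -[1+ _ ]  ne = refl
ones-suc zero    (+ zero)  ne = ⊥-elim (ne refl)
ones-suc (suc m) (+ zero)  ne = refl
ones-suc zero    (+ suc i) ne = refl
ones-suc (suc m) (+ suc i) ne = ones-suc m (+ i) (ne ∘ cong ℤ.suc)

write : Symbol → Tape → Tape
write s (tape ls _ rs) = tape ls s rs

+-cancel-≢ : ∀ {y : ℤ} {z} → y ≢ 0ℤ → y ℤ.+ z ≢ z
+-cancel-≢ {y} {z} ne eq = ne (trans (lem y z) (trans (cong (ℤ._- z) eq) (ℤ.i≡j⇒i-j≡0 {z} refl)))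
  where
  lem : ∀ y z → y ≡ y ℤ.+ z ℤ.- z
  lem = solve-∀

-- Blocks of m and of m + 1 ones differ in cell m only, which is the cell under the head.
ones-extend : ∀ {m t} → Ones m (+ m) t → Ones (suc m) (+ m) (write (just true) t)
ones-extend {m} h (+ zero)  = sym (ones-< {suc m} ≤-refl)
ones-extend {m} h (+ suc i) = trans (h (+ suc i)) (ones-suc m (+ suc i ℤ.+ + m) (+-cancel-≢ {+ suc i} λ ()))
ones-extend {m} h -[1+ i ]  = trans (h (-[1+ i ])) (ones-suc m (-[1+ i ] ℤ.+ + m) (+-cancel-≢ { -[1+ i ] } λ ()))

ones-shrink : ∀ {m t} → Ones (suc m) (+ m) t → Ones m (+ m) (write blank t)
ones-shrink {m} h (+ zero)  = sym (ones-≡ m)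
ones-shrink {m} h (+ suc i) = trans (h (+ suc i)) (sym (ones-suc m (+ suc i ℤ.+ + m) (+-cancel-≢ {+ suc i} λ ())))
ones-shrink {m} h -[1+ i ]  = trans (h (-[1+ i ])) (sym (ones-suc m (-[1+ i ] ℤ.+ + m) (+-cancel-≢ { -[1+ i ] } λ ())))

opposite : Move → Move
opposite left  = right
opposite stay  = stay
opposite right = left

dir-opposite : ∀ d → dir (opposite d) ≡ ℤ.- dir d
dir-opposite left  = refl
dir-opposite stay  = refl
dir-opposite right = refl

-- Output and remaining input of a loop, round by round

flat : ∀ {n} → (Fin n → List Bool) → List Bool
flat e = concat (tabulate e)

-- The output after i rounds when `o` was there before and round j appends `e j`.
prefix : ∀ {n} → List Bool → (Fin n → List Bool) → Fin (suc n) → List Bool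
prefix         o e zero    = o
prefix {suc n} o e (suc i) = prefix (o ++ e zero) (e ∘ suc) i

prefix-suc : ∀ {n} o (e : Fin n → List Bool) i →
             prefix o e (suc i) ≡ prefix o e (inject₁ i) ++ e i
prefix-suc o e zero    = refl
prefix-suc o e (suc i) = prefix-suc (o ++ e zero) (e ∘ suc) i

prefix-all : ∀ {n} o (e : Fin n → List Bool) → prefix o e (fromℕ n) ≡ o ++ flat e
prefix-all {zero}  o e = sym (++-identityʳ o)
prefix-all {suc n} o e = trans (prefix-all (o ++ e zero) (e ∘ suc)) (++-assoc o (e zero) _)

-- The input still to be read after i rounds when round j consumes `d j` and `w` follows the loop.
suffix : ∀ {n} → (Fin n → List Bool) → List Bool → Fin (suc n) → List Bool
suffix         d w zero    = flat d ++ w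
suffix {suc n} d w (suc i) = suffix (d ∘ suc) w i

suffix-inject₁ : ∀ {n} (d : Fin n → List Bool) w i →
                 suffix d w (inject₁ i) ≡ d i ++ suffix d w (suc i)
suffix-inject₁ d w zero    = ++-assoc (d zero) _ w
suffix-inject₁ d w (suc i) = suffix-inject₁ (d ∘ suc) w i

suffix-all : ∀ {n} (d : Fin n → List Bool) w → suffix d w (fromℕ n) ≡ w
suffix-all {zero}  d w = refl
suffix-all {suc n} d w = suffix-all (d ∘ suc) w

-- Timed Hoare triples for printing programs

module Emitters (r : ℕ) where

  open Programs (suc r) public

  -- Tape 0 receives the output, tape 1 holds the input still to be read, and each
  -- of the remaining r tapes carries a block of ones.
  record State : Set where
    constructor ⟨_,_,_,_⟩
    field
      blocks    : Fin r → ℕ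
      positions : Fin r → ℤ
      input     : List Bool
      emitted   : List Bool

  -- The blank before the output stops the final rewinding; `ls` is whatever lies further left, in
  -- the end the original input.
  Out : List Bool → Tape → Set
  Out o t = ∃[ ls ] t ≡ tape (List.map just o ʳ++ (blank ∷ ls)) blank []

  -- The explicit blank at the end is the cell from which the tape was rewound. Both the copied
  -- input and the finished output have this form.
  In : List Bool → Tape → Set
  In w t = scan t ∷ after t ≡ List.map just w ++ [ blank ]

  Blocks : (Fin r → ℕ) → (Fin r → ℤ) → Vec Tape r → Set
  Blocks ms zs ts = ∀ c → Ones (ms c) (zs c) (lookup ts c)

  data Rep : State → Tapes → Set where
    rep : ∀ {ms zs w o t₀ t₁ ts} → Out o t₀ → In w t₁ → Blocks ms zs ts →
          Rep ⟨ ms , zs , w , o ⟩ (t₀ ∷ t₁ ∷ ts)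

  -- A total-correctness triple: termination within `b` steps is part of it.
  Triple : Prog → ℕ → State → State → Set
  Triple p b σ σ′ = ∀ {ts} → Rep σ ts → ∃[ ts′ ] Exec p ts b ts′ × Rep σ′ ts′

  data _≈_ : State → State → Set where
    same : ∀ {ms ms′ zs zs′ w w′ o o′} → (∀ c → ms c ≡ ms′ c) → (∀ c → zs c ≡ zs′ c) →
           w ≡ w′ → o ≡ o′ → ⟨ ms , zs , w , o ⟩ ≈ ⟨ ms′ , zs′ , w′ , o′ ⟩

  rep-resp : ∀ {σ σ′ ts} → σ ≈ σ′ → Rep σ ts → Rep σ′ ts
  rep-resp (same ms zs refl refl) (rep o i h) =
    rep o i λ c → subst₂ (λ m z → Ones m z _) (ms c) (zs c) (h c)

  infixr 5 _then_
  _then_ : ∀ {p q b c σ σ′ σ″} → Triple p b σ σ′ → Triple q c σ′ σ″ →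
           Triple (p ⨾ q) (b + c) σ σ″
  (f then g) R = let _ , e , R′ = f R ; _ , e′ , R″ = g R′ in _ , exec-seq e e′ , R″

  post : ∀ {p b σ σ′ σ″} → σ′ ≈ σ″ → Triple p b σ σ′ → Triple p b σ σ″
  post eq f R = let _ , e , R′ = f R in _ , e , rep-resp eq R′

  pre : ∀ {p b σ σ′ σ″} → σ ≈ σ′ → Triple p b σ′ σ″ → Triple p b σ σ″
  pre eq f R = f (rep-resp eq R)

  weaken : ∀ {p b c σ σ′} → b ≤ c → Triple p b σ σ′ → Triple p c σ σ′
  weaken l f R = let _ , e , R′ = f R in _ , exec-weaken l e , R′

  Holds : (Symbols → Bool) → Bool → State → Set
  Holds test b σ = ∀ {ts} → Rep σ ts → test (scans ts) ≡ b

  while-up : ∀ {test p b} n (S : Fin (suc n) → State) →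
             (∀ i → Holds test true (S (inject₁ i))) → Holds test false (S (fromℕ n)) →
             (∀ i → Triple p b (S (inject₁ i)) (S (suc i))) →
             Triple (while test p) (n * suc b + 1) (S zero) (S (fromℕ n))
  while-up zero    S true? false? body R = _ , exec-done (false? R) , R
  while-up (suc n) S true? false? body R =
    let _ , e , R′  = body zero R
        _ , e′ , R″ = while-up n (S ∘ suc) (true? ∘ suc) false? (body ∘ suc) R′
    in _ , exec-weaken (s≤s (≤-reflexive (sym (+-assoc _ (n * suc _) 1))))
             (exec-again (true? zero R) e e′) , R″

  while-down : ∀ {test p b} (S : ℕ → State) n →
               (∀ j → j < n → Holds test true (S (suc j))) → Holds test false (S 0) →
               (∀ j → j < n → Triple p b (S (suc j)) (S j)) →
               Triple (while test p) (n * suc b + 1) (S n) (S 0)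
  while-down S zero    true? false? body R = _ , exec-done (false? R) , R
  while-down S (suc n) true? false? body R =
    let _ , e , R′  = body n ≤-refl R
        _ , e′ , R″ = while-down S n (λ j l → true? j (m<n⇒m<1+n l)) false?
                        (λ j l → body j (m<n⇒m<1+n l)) R′
    in _ , exec-weaken (s≤s (≤-reflexive (sym (+-assoc _ (n * suc _) 1))))
             (exec-again (true? n ≤-refl R) e e′) , R″

  -- `local` sees only the symbol on its own tape, so that its effect on the blocks can be checked
  -- tape by tape.
  record Instruction : Set where
    field
      emission : Symbol → Vec Symbol r → Maybe Bool
      advance  : Bool
      local    : Fin r → Symbol → Symbol × Move

  emitting : Maybe Bool → Symbol → Symbol × Move
  emitting nothing  s = s , stay
  emitting (just b) s = just b , right

  advancing : Bool → Move
  advancing true  = right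
  advancing false = stay

  actions : Instruction → Symbols → Actions
  actions I (s₀ ∷ s₁ ∷ ss) =
    emitting (emission s₁ ss) s₀ ∷ (s₁ , advancing advance) ∷
    Vec.tabulate (λ c → local c (lookup ss c))
    where open Instruction I

  instr : Instruction → Prog
  instr I = op (actions I)

  keep : (Fin r → Move) → Fin r → Symbol → Symbol × Move
  keep μ c s = s , μ c

  data Emits : Maybe Bool → List Bool → List Bool → Set where
    silent : ∀ {o} → Emits nothing o o
    bit    : ∀ {b o} → Emits (just b) o (o ++ [ b ])

  data Consumes : Bool → List Bool → List Bool → Set where
    kept    : ∀ {w} → Consumes false w w
    dropped : ∀ {b w} → Consumes true (b ∷ w) w

  out-step : ∀ {e o o′ t} → Emits e o o′ → Out o t → Out o′ (act (emitting e (scan t)) t)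
  out-step silent h = h
  out-step {o = o} (bit {b}) (ls , refl) = ls , cong (λ x → tape x blank [])
    (sym (trans (cong (_ʳ++ (blank ∷ ls)) (map-++ just o [ b ])) (++-ʳ++ (List.map just o))))

  in-step : ∀ {a w w′ t} → Consumes a w w′ → In w t → In w′ (act (scan t , advancing a) t)
  in-step kept h = h
  in-step {w′ = []}     {tape _ _ (r ∷ rs)} dropped h = ∷-injectiveʳ h
  in-step {w′ = []}     {tape _ _ []} dropped ()
  in-step {w′ = x ∷ w′} {tape _ _ (r ∷ rs)} dropped h = ∷-injectiveʳ h
  in-step {w′ = x ∷ w′} {tape _ _ []} dropped ()

  perform-local : ∀ {ms zs ms′ zs′} (g : Fin r → Symbol → Symbol × Move) {ts} →
    (∀ c {t} → Ones (ms c) (zs c) t → Ones (ms′ c) (zs′ c) (act (g c (scan t)) t)) →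
    Blocks ms zs ts →
    Blocks ms′ zs′ (Vec.zipWith act (Vec.tabulate (λ c → g c (lookup (Vec.map scan ts) c))) ts)
  perform-local {ms′ = ms′} {zs′} g {ts} ok hb c =
    subst (Ones (ms′ c) (zs′ c)) (sym locally) (ok c (hb c))
    where
    h : Fin r → Symbol × Move
    h c = g c (lookup (Vec.map scan ts) c)
    locally : lookup (Vec.zipWith act (Vec.tabulate h) ts) c
            ≡ act (g c (scan (lookup ts c))) (lookup ts c)
    locally = trans (lookup-zipWith act c (Vec.tabulate h) ts) (cong (λ a → act a (lookup ts c))
      (trans (lookup∘tabulate h c) (cong (g c) (lookup-map c scan ts))))

  instr-rule : ∀ I {ms zs w o ms′ zs′ w′ o′} e → let open Instruction I in
    (∀ t₁ ts → In w t₁ → Blocks ms zs ts → emission (scan t₁) (Vec.map scan ts) ≡ e) →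
    Emits e o o′ → Consumes advance w w′ →
    (∀ c {t} → Ones (ms c) (zs c) t → Ones (ms′ c) (zs′ c) (act (local c (scan t)) t)) →
    Triple (instr I) 1 ⟨ ms , zs , w , o ⟩ ⟨ ms′ , zs′ , w′ , o′ ⟩
  instr-rule I {o′ = o′} e em eo cw ok (rep {t₀ = t₀} {t₁} {ts} ho hi hb) =
    _ , exec-op , rep
      (subst (λ e → Out o′ (act (emitting e (scan t₀)) t₀)) (sym (em t₁ ts hi hb)) (out-step eo ho))
      (in-step cw hi)
      (perform-local (Instruction.local I) ok hb)

  emit-instruction : (Symbol → Vec Symbol r → Bool) → Instruction
  emit-instruction f = record
    { emission = λ s ss → just (f s ss) ; advance = false ; local = keep (λ _ → stay) }

  emit : (Symbol → Vec Symbol r → Bool) → Prog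
  emit f = instr (emit-instruction f)

  emit-rule : ∀ {f ms zs w o} b →
    (∀ t₁ ts → In w t₁ → Blocks ms zs ts → f (scan t₁) (Vec.map scan ts) ≡ b) →
    Triple (emit f) 1 ⟨ ms , zs , w , o ⟩ ⟨ ms , zs , w , o ++ [ b ] ⟩
  emit-rule {f} b h = instr-rule (emit-instruction f) (just b) (λ t₁ ts i k → cong just (h t₁ ts i k)) bit kept (λ _ k → k)

  shift-instruction : (Fin r → Move) → Instruction
  shift-instruction μ = record
    { emission = λ _ _ → nothing ; advance = false ; local = keep μ }

  shift : (Fin r → Move) → Prog
  shift μ = instr (shift-instruction μ)

  shift-rule : ∀ {μ ms zs w o} → Triple (shift μ) 1 ⟨ ms , zs , w , o ⟩
                 ⟨ ms , (λ c → zs c ℤ.+ dir (μ c)) , w , o ⟩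
  shift-rule {μ} = instr-rule (shift-instruction μ) nothing (λ _ _ _ _ → refl) silent kept (λ c → ones-move (μ c))

  skip-instruction : Instruction
  skip-instruction = record
    { emission = λ _ _ → nothing ; advance = true ; local = keep (λ _ → stay) }

  skip : Prog
  skip = instr skip-instruction

  skip-rule : ∀ {ms zs b w o} → Triple skip 1 ⟨ ms , zs , b ∷ w , o ⟩ ⟨ ms , zs , w , o ⟩
  skip-rule = instr-rule skip-instruction nothing (λ _ _ _ _ → refl) silent dropped (λ _ k → k)

  at : Fin r → Symbols → Bool
  at c (_ ∷ _ ∷ ss) = is-just (lookup ss c)

  at-holds : ∀ c {ms zs w o b} → is-just (ones (ms c) (zs c)) ≡ b →
             Holds (at c) b ⟨ ms , zs , w , o ⟩
  at-holds c eq (rep {ts = ts} _ _ hb) =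
    trans (cong is-just (trans (lookup-map c scan ts) (ones-scan (hb c)))) eq

  only : Fin r → Move → Fin r → Move
  only c d c′ = if does (c Fin.≟ c′) then d else stay

  only-self : ∀ c d → only c d c ≡ d
  only-self c d with c Fin.≟ c
  ... | yes _ = refl
  ... | no ne = ⊥-elim (ne refl)

  -- Tape c runs one cell ahead, so that it leaves its block of ones exactly when
  -- the moves of the loop have been undone.
  rewind : Fin r → (Fin r → Move) → Prog
  rewind c μ =
    shift (only c left) ⨾ while (at c) (shift (opposite ∘ μ)) ⨾ shift (only c right)

  for : Fin r → (Fin r → Move) → Prog → Prog
  for c μ p = while (at c) (p ⨾ shift μ) ⨾ rewind c μ

  infixl 6 _⊹_·_
  _⊹_·_ : (Fin r → ℤ) → ℕ → (Fin r → Move) → Fin r → ℤ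
  (zs ⊹ i · μ) c = zs c ℤ.+ + i ℤ.* dir (μ c)

  rewind-rule : ∀ {c μ ms zs w o} → μ c ≡ right → zs c ≡ 0ℤ →
    Triple (rewind c μ) (ms c * 2 + 3) ⟨ ms , zs ⊹ ms c · μ , w , o ⟩ ⟨ ms , zs , w , o ⟩
  rewind-rule {c} {μ} {ms} {zs} {w} {o} μc zc = weaken (≤-reflexive (lem (ms c)))
    (shift-rule then
     while-down S (ms c)
       (λ j l → at-holds c (cong is-just (trans (cong (ones (ms c)) (at-c (suc j))) (ones-< l))))
       (at-holds c (cong (is-just ∘ ones (ms c)) (at-c 0)))
       (λ j l → post (same (λ _ → refl) (back j) refl refl) shift-rule) then
     post (same (λ _ → refl) restore refl refl) shift-rule)
    where
    lem : ∀ m → 1 + (m * 2 + 1 + 1) ≡ m * 2 + 3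
    lem m = trans (+-comm 1 _) (trans (+-assoc (m * 2 + 1) 1 1) (+-assoc (m * 2) 1 2))
    zs′ : ℕ → Fin r → ℤ
    zs′ j c′ = (zs ⊹ j · μ) c′ ℤ.+ dir (only c left c′)
    S : ℕ → State
    S j = ⟨ ms , zs′ j , w , o ⟩
    at-c : ∀ j → zs′ j c ≡ + j ℤ.+ -1ℤ
    at-c j rewrite μc | zc | only-self c left | ℤ.*-identityʳ (+ j) | ℤ.+-identityˡ (+ j) = refl
    back : ∀ j c′ → zs′ (suc j) c′ ℤ.+ dir (opposite (μ c′)) ≡ zs′ j c′
    back j c′ rewrite dir-opposite (μ c′) = ring (zs c′) (+ j) (dir (μ c′)) _
      where
      ring : ∀ z j d e → z ℤ.+ (1ℤ ℤ.+ j) ℤ.* d ℤ.+ e ℤ.+ ℤ.- d ≡ z ℤ.+ j ℤ.* d ℤ.+ e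
      ring = solve-∀
    restore : ∀ c′ → zs′ 0 c′ ℤ.+ dir (only c right c′) ≡ zs c′
    restore c′ with does (c Fin.≟ c′)
    ... | true  = ring (zs c′) (dir (μ c′))
      where
      ring : ∀ z d → z ℤ.+ 0ℤ ℤ.* d ℤ.+ -1ℤ ℤ.+ 1ℤ ≡ z
      ring = solve-∀
    ... | false = ring (zs c′) (dir (μ c′))
      where
      ring : ∀ z d → z ℤ.+ 0ℤ ℤ.* d ℤ.+ 0ℤ ℤ.+ 0ℤ ≡ z
      ring = solve-∀

  -- A round pays for its body, a test and a shift on the way out, and a test and a shift on the way
  -- back. The last 4 covers two failing tests and the two single shifts around the rewinding.
  for-cost : ℕ → ℕ → ℕ
  for-cost b n = n * (b + 4) + 4

  -- The body must restore all positions, and the rewinding undoes the shifts, so the loop restores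
  -- them too and can serve as the body of another loop.
  for-rule : ∀ {c μ p b ms zs n} (W : Fin (suc n) → List Bool) (e : Fin n → List Bool) →
    μ c ≡ right → zs c ≡ 0ℤ → ms c ≡ n →
    (∀ i o → Triple p b ⟨ ms , zs ⊹ toℕ i · μ , W (inject₁ i) , o ⟩
                        ⟨ ms , zs ⊹ toℕ i · μ , W (suc i) , o ++ e i ⟩) →
    ∀ {o} → Triple (for c μ p) (for-cost b n) ⟨ ms , zs , W zero , o ⟩
                   ⟨ ms , zs , W (fromℕ n) , o ++ flat e ⟩
  for-rule {c} {μ} {p} {b} {ms} {zs} W e μc zc refl body {o} =
    weaken (≤-reflexive (lem n b))
      (pre (same (λ _ → refl) start refl refl)
        (while-up n S
          (λ i → at-holds c (cong is-just (trans (cong (ones n) (at-c (inject₁ i)))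
            (ones-< (subst (_< n) (sym (toℕ-inject₁ i)) (toℕ<n i))))))
          (at-holds c (cong is-just (trans (cong (ones n) (trans (at-c (fromℕ n)) (cong +_ (toℕ-fromℕ n))))
            (ones-≡ n))))
          (λ i → pre (same (λ _ → refl) (λ c′ → cong (λ j → zs c′ ℤ.+ + j ℤ.* dir (μ c′)) (toℕ-inject₁ i)) refl refl)
                 (body i _ then
                  post (same (λ _ → refl) (forth i) refl (sym (prefix-suc o e i))) shift-rule)))
       then pre (same (λ _ → refl) (λ c′ → cong (λ j → zs c′ ℤ.+ + j ℤ.* dir (μ c′)) (toℕ-fromℕ n))
                      refl (prefix-all o e))
                (rewind-rule μc zc))
    where
    n = ms c
    S : Fin (suc n) → State
    S i = ⟨ ms , zs ⊹ toℕ i · μ , W i , prefix o e i ⟩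
    lem : ∀ n b → n * suc (b + 1) + 1 + (n * 2 + 3) ≡ n * (b + 4) + 4
    lem = ℕ-Solver.solve-∀
    start : ∀ c′ → zs c′ ≡ (zs ⊹ 0 · μ) c′
    start c′ = ring (zs c′) (dir (μ c′))
      where
      ring : ∀ z d → z ≡ z ℤ.+ 0ℤ ℤ.* d
      ring = solve-∀
    at-c : ∀ (i : Fin (suc n)) → (zs ⊹ toℕ i · μ) c ≡ + toℕ i
    at-c i rewrite μc | zc | ℤ.*-identityʳ (+ toℕ i) = ℤ.+-identityˡ _
    forth : ∀ (i : Fin n) c′ → (zs ⊹ toℕ i · μ) c′ ℤ.+ dir (μ c′) ≡ (zs ⊹ suc (toℕ i) · μ) c′
    forth i c′ = ring (zs c′) (+ toℕ i) (dir (μ c′))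
      where
      ring : ∀ z j d → z ℤ.+ j ℤ.* d ℤ.+ d ≡ z ℤ.+ (1ℤ ℤ.+ j) ℤ.* d
      ring = solve-∀

-- The reduction and the program computing it

open Emitters 7

Vertex : ℕ → Set
Vertex n = Fin n × Fin (suc n)

-- (u , 0) is the hub at u, and (u , 1 + a) the leaf of its star that faces a.
linked : ∀ {n} → Graph n → Vertex n → Vertex n → Bool
linked G (u , zero)  (v , zero)  = false
linked G (u , zero)  (v , suc b) = does (u ≟ v)
linked G (u , suc a) (v , zero)  = does (u ≟ v)
linked G (u , suc a) (v , suc b) = does (a ≟ v) ∧ (does (u ≟ b) ∧ adj G u a)

flat-cong : ∀ {n} {e e′ : Fin n → List Bool} → (∀ i → e i ≡ e′ i) → flat e ≡ flat e′
flat-cong {zero}  h = refl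
flat-cong {suc n} h = cong₂ _++_ (h zero) (flat-cong (h ∘ suc))

tabulate-flat : ∀ {n} (f : Fin n → Bool) → tabulate f ≡ flat (λ i → [ f i ])
tabulate-flat {zero}  f = refl
tabulate-flat {suc n} f = cong (f zero ∷_) (tabulate-flat (f ∘ suc))

concatMap-flat : ∀ {n} (f : Fin n → List Bool) → concatMap f (allFin n) ≡ flat f
concatMap-flat f = cong concat (map-tabulate id f)

map-allFin-flat : ∀ {n} (f : Fin n → Bool) → map f (allFin n) ≡ flat (λ i → [ f i ])
map-allFin-flat f = trans (map-tabulate id f) (tabulate-flat f)

flat-+ : ∀ m {n} (e : Fin (m + n) → List Bool) →
         flat e ≡ flat (λ i → e (i ↑ˡ n)) ++ flat (λ i → e (m ↑ʳ i))
flat-+ zero    e = refl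
flat-+ (suc m) e = trans (cong (e zero ++_) (flat-+ m (e ∘ suc))) (sym (++-assoc (e zero) _ _))

flat-* : ∀ m {n} (e : Fin (m * n) → List Bool) →
         flat e ≡ flat {m} (λ i → flat {n} (λ j → e (combine i j)))
flat-* zero        e = refl
flat-* (suc m) {n} e = trans (flat-+ n e) (cong (flat (λ j → e (j ↑ˡ (m * n))) ++_) (flat-* m (λ i → e (n ↑ʳ i))))

replicate-flat : ∀ n → replicate n true ≡ flat {n} (λ _ → [ true ])
replicate-flat zero    = refl
replicate-flat (suc n) = cong (true ∷_) (replicate-flat n)

mark : ∀ {n} (i j : Fin n) {x} → x ≡ + toℕ j ℤ.- + toℕ i → is-just (ones 1 x) ≡ does (i ≟ j)
mark i j {x} eq with i ≟ j
... | yes refl rewrite eq | ℤ.+-inverseʳ (+ toℕ i) = refl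
... | no ne    = off x λ x≡0 → ne (toℕ-injective (ℤ.+-injective
                   (sym (ℤ.i-j≡0⇒i≡j (+ toℕ j) (+ toℕ i) (trans (sym eq) x≡0)))))
  where
  off : ∀ x → x ≢ 0ℤ → is-just (ones 1 x) ≡ false
  off (+ zero)  ne = ⊥-elim (ne refl)
  off (+ suc i) ne = refl
  off -[1+ i ]  ne = refl

-- The loops that print the expanded matrix

counter-u counter-a counter-v counter-b mark-uv mark-av mark-ub : Fin 7
counter-u = # 0
counter-a = # 1
counter-v = # 2
counter-b = # 3
mark-uv   = # 4
mark-av   = # 5
mark-ub   = # 6

-- The head of mark-xy stands y − x cells from a single mark, so that it reads
-- the mark exactly when x = y.
loop-u loop-a loop-v loop-b : Fin 7 → Move
loop-u = lookup (right ∷ stay  ∷ stay  ∷ stay  ∷ left  ∷ stay  ∷ left  ∷ [])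
loop-a = lookup (stay  ∷ right ∷ stay  ∷ stay  ∷ stay  ∷ left  ∷ stay  ∷ [])
loop-v = lookup (stay  ∷ stay  ∷ right ∷ stay  ∷ right ∷ right ∷ stay  ∷ [])
loop-b = lookup (stay  ∷ stay  ∷ stay  ∷ right ∷ stay  ∷ stay  ∷ right ∷ [])

marked : Fin 7 → Vec Symbol 7 → Bool
marked c ss = is-just (lookup ss c)

isOne : Symbol → Bool
isOne (just true) = true
isOne _           = false

emit-bit : Bool → Prog
emit-bit b = emit (λ _ _ → b)

emit-joined : Symbol → Vec Symbol 7 → Bool
emit-joined s ss = marked mark-av ss ∧ (marked mark-ub ss ∧ isOne s)

header rows : Prog
-- Each u contributes a one for its hub and n ones for its leaves.
header = for counter-u loop-u (emit-bit true ⨾ for counter-b loop-b (emit-bit true)) ⨾ emit-bit false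
rows   = for counter-u loop-u
  -- The row of the hub at u; hubs are never adjacent, hence the constant bit in each column (v ,
  -- 0).
  (  for counter-v loop-v (emit-bit false ⨾ for counter-b loop-b (emit (λ _ → marked mark-uv)))
   ⨾ for counter-a loop-a
       -- The entry at (u , a) stays under the input head during this whole row; `skip` passes to
       -- the next one.
       (  for counter-v loop-v (emit (λ _ → marked mark-uv) ⨾ for counter-b loop-b (emit emit-joined))
        ⨾ skip))

isCounter : Fin 7 → Bool
isCounter c = toℕ c <ᵇ 4

blocks : ℕ → Fin 7 → ℕ
blocks n c = if isCounter c then n else 1

home : Fin 7 → ℤ
home _ = 0ℤ

standing : ℤ → Fin 7 → ℤ
standing z c = if isCounter c then z else 0ℤ

header-output : ℕ → List Bool
header-output n = flat {n} (λ u → true ∷ flat {n} (λ b → [ true ])) ++ [ false ]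

hub-row : ∀ {n} → Fin n → List Bool
hub-row {n} u = flat {n} λ v → false ∷ flat {n} λ b → [ does (u ≟ v) ]

half-edge-row : ∀ {n} → Graph n → Fin n → Fin n → List Bool
half-edge-row {n} G u a =
  flat {n} λ v → does (u ≟ v) ∷ flat {n} λ b → [ does (a ≟ v) ∧ (does (u ≟ b) ∧ adj G u a) ]

rows-output : ∀ {n} → Graph n → List Bool
rows-output {n} G = flat {n} λ u → hub-row u ++ flat {n} (half-edge-row G u)

adjacency : ∀ {n} → Graph n → Fin n → List Bool
adjacency G u = flat λ a → [ adj G u a ]

for²-cost : ℕ → ℕ
for²-cost n = for-cost (1 + for-cost 1 n) n

header-cost rows-cost : ℕ → ℕ
header-cost n = for²-cost n + 1
rows-cost n   = for-cost (for²-cost n + for-cost (for²-cost n + 1) n) n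

emitted-eq : ∀ {ms zs w o o′} → o ≡ o′ → ⟨ ms , zs , w , o ⟩ ≈ ⟨ ms , zs , w , o′ ⟩
emitted-eq = same (λ _ → refl) (λ _ → refl) refl

header-rule : ∀ n {w o} → Triple header (header-cost n) ⟨ blocks n , home , w , o ⟩
                                 ⟨ blocks n , home , w , o ++ header-output n ⟩
header-rule n {w} {o} = post (emitted-eq (++-assoc o _ _))
  (for-rule (λ _ → w) (λ u → true ∷ flat {n} (λ b → [ true ])) refl refl refl
     (λ u o → post (emitted-eq (++-assoc o _ _))
       (emit-rule true (λ _ _ _ _ → refl) then
        for-rule (λ _ → w) (λ b → [ true ]) refl (lem (+ toℕ u)) refl
          (λ b o → emit-rule true (λ _ _ _ _ → refl)))) then
   emit-rule false (λ _ _ _ _ → refl))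
  where
  lem : ∀ u → 0ℤ ℤ.+ u ℤ.* 0ℤ ≡ 0ℤ
  lem = solve-∀

marked-rule : ∀ {n} c {ms zs ts} (i j : Fin n) → ms c ≡ 1 → zs c ≡ + toℕ j ℤ.- + toℕ i →
              Blocks ms zs ts → marked c (Vec.map scan ts) ≡ does (i ≟ j)
marked-rule c {ms} {zs} {ts} i j m z h = trans (cong is-just (trans (lookup-map c scan ts) (ones-scan (h c))))
  (trans (cong (λ m → is-just (ones m (zs c))) m) (mark i j z))

isOne-rule : ∀ {b w t} → In (b ∷ w) t → isOne (scan t) ≡ b
isOne-rule {true}  h = cong isOne (∷-injectiveˡ h)
isOne-rule {false} h = cong isOne (∷-injectiveˡ h)

rows-rule : ∀ {n} (G : Graph n) {w o} → Triple rows (rows-cost n)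
  ⟨ blocks n , home , flat (adjacency G) ++ w , o ⟩
  ⟨ blocks n , home , w , o ++ rows-output G ⟩
rows-rule {n} G {w} {o} =
  post (same (λ _ → refl) (λ _ → refl) (suffix-all (adjacency G) w) refl)
  (for-rule W (λ u → hub-row u ++ flat (half-edge-row G u)) refl refl refl row)
  where
  W : Fin (suc n) → List Bool
  W = suffix (adjacency G) w

  module _ (u : Fin n) where
    zero₁ : ∀ x → 0ℤ ℤ.+ x ℤ.* 0ℤ ≡ 0ℤ
    zero₁ = solve-∀
    zero₂ : ∀ x y → 0ℤ ℤ.+ x ℤ.* 0ℤ ℤ.+ y ℤ.* 0ℤ ≡ 0ℤ
    zero₂ = solve-∀
    zero₃ : ∀ x y z → 0ℤ ℤ.+ x ℤ.* 0ℤ ℤ.+ y ℤ.* 0ℤ ℤ.+ z ℤ.* 0ℤ ≡ 0ℤ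
    zero₃ = solve-∀
    -- Head positions of the marks: one summand for each enclosing loop, outermost first.
    uv-hub : ∀ u v b → 0ℤ ℤ.+ u ℤ.* -1ℤ ℤ.+ v ℤ.* 1ℤ ℤ.+ b ℤ.* 0ℤ ≡ v ℤ.- u
    uv-hub = solve-∀
    uv-half : ∀ u a v → 0ℤ ℤ.+ u ℤ.* -1ℤ ℤ.+ a ℤ.* 0ℤ ℤ.+ v ℤ.* 1ℤ ≡ v ℤ.- u
    uv-half = solve-∀
    av-half : ∀ u a v b → 0ℤ ℤ.+ u ℤ.* 0ℤ ℤ.+ a ℤ.* -1ℤ ℤ.+ v ℤ.* 1ℤ ℤ.+ b ℤ.* 0ℤ ≡ v ℤ.- a
    av-half = solve-∀
    ub-half : ∀ u a v b → 0ℤ ℤ.+ u ℤ.* -1ℤ ℤ.+ a ℤ.* 0ℤ ℤ.+ v ℤ.* 0ℤ ℤ.+ b ℤ.* 1ℤ ≡ b ℤ.- u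
    ub-half = solve-∀

    at-u : Fin 7 → ℤ
    at-u = home ⊹ toℕ u · loop-u

    hub : ∀ {w o} → Triple (for counter-v loop-v (emit-bit false ⨾ for counter-b loop-b (emit (λ _ → marked mark-uv))))
            (for²-cost n) ⟨ blocks n , at-u , w , o ⟩ ⟨ blocks n , at-u , w , o ++ hub-row u ⟩
    hub {w} = for-rule (λ _ → w) (λ v → false ∷ flat {n} (λ b → [ does (u ≟ v) ])) refl (zero₁ (+ toℕ u)) refl
      λ v o → post (emitted-eq (++-assoc o _ _))
        (emit-rule false (λ _ _ _ _ → refl) then
         for-rule (λ _ → w) (λ b → [ does (u ≟ v) ]) refl (zero₂ (+ toℕ u) (+ toℕ v)) refl
           λ b o → emit-rule (does (u ≟ v)) λ _ ts _ h →
             marked-rule mark-uv {ts = ts} u v refl (uv-hub (+ toℕ u) (+ toℕ v) (+ toℕ b)) h)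

    half : ∀ a {w o} → Triple
             (for counter-v loop-v (emit (λ _ → marked mark-uv) ⨾ for counter-b loop-b (emit emit-joined)))
             (for²-cost n) ⟨ blocks n , at-u ⊹ toℕ a · loop-a , adj G u a ∷ w , o ⟩
             ⟨ blocks n , at-u ⊹ toℕ a · loop-a , adj G u a ∷ w , o ++ half-edge-row G u a ⟩
    half a {w} = for-rule (λ _ → adj G u a ∷ w)
      (λ v → does (u ≟ v) ∷ flat {n} λ b → [ does (a ≟ v) ∧ (does (u ≟ b) ∧ adj G u a) ])
      refl (zero₂ (+ toℕ u) (+ toℕ a)) refl
      λ v o → post (emitted-eq (++-assoc o _ _))
        (emit-rule (does (u ≟ v)) (λ _ ts _ h →
           marked-rule mark-uv {ts = ts} u v refl (uv-half (+ toℕ u) (+ toℕ a) (+ toℕ v)) h) then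
         for-rule (λ _ → adj G u a ∷ w) (λ b → [ does (a ≟ v) ∧ (does (u ≟ b) ∧ adj G u a) ])
           refl (zero₃ (+ toℕ u) (+ toℕ a) (+ toℕ v)) refl
           λ b o → emit-rule _ λ t₁ ts i h → cong₂ _∧_
             (marked-rule mark-av {ts = ts} a v refl (av-half (+ toℕ u) (+ toℕ a) (+ toℕ v) (+ toℕ b)) h)
             (cong₂ _∧_
               (marked-rule mark-ub {ts = ts} u b refl (ub-half (+ toℕ u) (+ toℕ a) (+ toℕ v) (+ toℕ b)) h)
               (isOne-rule {w = w} {t₁} i)))

    row : ∀ o → Triple _ _ ⟨ blocks n , at-u , W (inject₁ u) , o ⟩
                           ⟨ blocks n , at-u , W (suc u) , o ++ (hub-row u ++ flat (half-edge-row G u)) ⟩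
    row o = pre (same (λ _ → refl) (λ _ → refl) (suffix-inject₁ (adjacency G) w u) refl)
      (hub then
       -- The n skips use up row u of the matrix and leave `W (suc u)`.
       post (same (λ _ → refl) (λ _ → refl) (suffix-all (λ a → [ adj G u a ]) (W (suc u))) (++-assoc o _ _))
       (for-rule (suffix (λ a → [ adj G u a ]) (W (suc u))) (half-edge-row G u) refl (zero₁ (+ toℕ u)) refl
         λ a o → pre (same (λ _ → refl) (λ _ → refl) (suffix-inject₁ (λ a → [ adj G u a ]) (W (suc u)) a) refl)
           (half a then skip-rule)))

-- The expanded graph and its encoding

no-loop : ∀ {n} {G : Graph n} {u} → ¬ Adj G u u
no-loop {G = G} {u} h = case trans (sym h) (Graph.irrefl G u) of λ ()

data Joined {n} (G : Graph n) : Vertex n → Vertex n → Set where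
  spoke  : ∀ u a → Joined G (u , zero) (u , suc a)
  spoke′ : ∀ u a → Joined G (u , suc a) (u , zero)
  link   : ∀ {u a} → Adj G u a → Joined G (u , suc a) (a , suc u)

joined-sym : ∀ {n} {G : Graph n} {x y} → Joined G x y → Joined G y x
joined-sym (spoke u a)  = spoke′ u a
joined-sym (spoke′ u a) = spoke u a
joined-sym {G = G} (link {u} {a} h) = link (trans (Graph.sym G a u) h)

joined-irrefl : ∀ {n} {G : Graph n} {x} → ¬ Joined G x x
joined-irrefl {G = G} (link h) = no-loop {G = G} h

linked⇒joined : ∀ {n} (G : Graph n) x y → linked G x y ≡ true → Joined G x y
linked⇒joined G (u , zero)  (v , zero)  ()
linked⇒joined G (u , zero)  (v , suc b) h with yes refl ← u ≟ v = spoke u b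
linked⇒joined G (u , suc a) (v , zero)  h with yes refl ← u ≟ v = spoke′ u a
linked⇒joined G (u , suc a) (v , suc b) h with yes refl ← a ≟ v with yes refl ← u ≟ b = link h

joined⇒linked : ∀ {n} {G : Graph n} {x y} → Joined G x y → linked G x y ≡ true
joined⇒linked (spoke u a)  = dec-true (u ≟ u) refl
joined⇒linked (spoke′ u a) = dec-true (u ≟ u) refl
joined⇒linked (link {u} {a} h) rewrite dec-true (a ≟ a) refl | dec-true (u ≟ u) refl = h

bool-ext : ∀ {b c : Bool} → (b ≡ true → c ≡ true) → (c ≡ true → b ≡ true) → b ≡ c
bool-ext {true}          f g = sym (f refl)
bool-ext {false} {true}  f g = g refl
bool-ext {false} {false} f g = refl

expand : ∀ {n} → Graph n → Graph (n * suc n)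
expand {n} G = record
  { adj    = λ x y → linked G (remQuot (suc n) x) (remQuot (suc n) y)
  ; sym    = λ x y → bool-ext (mirrored x y) (mirrored y x)
  ; irrefl = λ x → bool-ext (⊥-elim ∘ joined-irrefl ∘ linked⇒joined G _ (remQuot (suc n) x)) λ ()
  }
  where
  mirrored : ∀ x y → linked G (remQuot (suc n) x) (remQuot (suc n) y) ≡ true →
                 linked G (remQuot (suc n) y) (remQuot (suc n) x) ≡ true
  mirrored x y = joined⇒linked ∘ joined-sym ∘ linked⇒joined G (remQuot (suc n) x) (remQuot (suc n) y)

encode-flat : ∀ {n} (G : Graph n) → encodeGraph G ≡ replicate n true ++ false ∷ flat (λ u → flat (λ v → [ adj G u v ]))
encode-flat G = cong (λ x → _ ++ false ∷ x) (trans (concatMap-flat (λ u → map (adj G u) (allFin _))) (flat-cong (λ u → map-allFin-flat (adj G u))))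

-- `combine` numbers vertices lexicographically, so by `flat-*` a pass over all n (n + 1) indices is
-- the nested loop over hubs and star members that the program runs.
encode-expand : ∀ {n} (G : Graph n) → encodeGraph (expand G) ≡ header-output n ++ rows-output G
encode-expand {n} G = trans (encode-flat (expand G)) (trans (cong₂ (λ x y → x ++ false ∷ y) hd bd)
  (sym (++-assoc (flat {n} (λ u → true ∷ flat {n} (λ b → [ true ]))) [ false ] (rows-output G))))
  where
  hd : replicate (n * suc n) true ≡ flat {n} (λ u → true ∷ flat {n} (λ b → [ true ]))
  hd = trans (replicate-flat (n * suc n)) (flat-* n (λ _ → [ true ]))
  row : ∀ x → flat (λ y → [ linked G x (remQuot (suc n) y) ]) ≡
              flat {n} (λ v → linked G x (v , zero) ∷ flat {n} (λ b → [ linked G x (v , suc b) ]))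
  row x = trans (flat-* n (λ y → [ linked G x (remQuot (suc n) y) ]))
    (flat-cong {n} λ v → flat-cong {suc n} λ j → cong (λ y → [ linked G x y ]) (remQuot-combine v j))
  bd : flat (λ x → flat (λ y → [ adj (expand G) x y ])) ≡ rows-output G
  bd = trans (flat-cong (λ x → row (remQuot (suc n) x)))
    (trans (flat-* n (λ x → flat {n} (λ v → linked G (remQuot (suc n) x) (v , zero) ∷ flat {n} (λ b → [ linked G (remQuot (suc n) x) (v , suc b) ]))))
    (flat-cong {n} λ u → flat-cong {suc n} λ i →
      cong (λ x → flat {n} (λ v → linked G x (v , zero) ∷ flat {n} (λ b → [ linked G x (v , suc b) ])))
        (remQuot-combine u i)))

-- Filling and erasing the counters

counters-move : Move → Fin 7 → Move
counters-move d c = if isCounter c then d else stay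

scanned-one : Symbols → Bool
scanned-one (_ ∷ s ∷ _) = isOne s

read-order-instruction erase-instruction : Instruction
read-order-instruction = record
  { emission = λ _ _ → nothing
  ; advance  = true
  ; local    = λ c s → if isCounter c then (just true , right) else (s , stay)
  }
erase-instruction = record
  { emission = λ _ _ → nothing
  ; advance  = false
  ; local    = λ c s → if isCounter c then (blank , left) else (s , stay)
  }

read-order erase-counters expand-one : Prog
read-order = while scanned-one (instr read-order-instruction) ⨾ skip ⨾ rewind counter-u (counters-move right)
-- The second graph may have another order, so its counters must start empty.
erase-counters =
    while (at counter-u) (shift (counters-move right))
  ⨾ shift (counters-move left)
  ⨾ while (at counter-u) (instr erase-instruction)
  ⨾ shift (counters-move right)
expand-one = read-order ⨾ header ⨾ rows ⨾ erase-counters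

standing-⊹ : ∀ n c → standing (+ n) c ≡ (home ⊹ n · counters-move right) c
standing-⊹ n c with isCounter c
... | true  = ring (+ n)
  where
  ring : ∀ n → n ≡ 0ℤ ℤ.+ n ℤ.* 1ℤ
  ring = solve-∀
... | false = ring (+ n)
  where
  ring : ∀ n → 0ℤ ≡ 0ℤ ℤ.+ n ℤ.* 0ℤ
  ring = solve-∀

standing-move : ∀ d z c → standing z c ℤ.+ dir (counters-move d c) ≡ standing (z ℤ.+ dir d) c
standing-move d z c with isCounter c
... | true  = refl
... | false = refl

standing-home : ∀ c → standing 0ℤ c ≡ home c
standing-home c with isCounter c
... | true  = refl
... | false = refl

positions-eq : ∀ {ms zs zs′ w o} → (∀ c → zs c ≡ zs′ c) → ⟨ ms , zs , w , o ⟩ ≈ ⟨ ms , zs′ , w , o ⟩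
positions-eq h = same (λ _ → refl) h refl refl

read-cost : ℕ → ℕ
read-cost n = (n * 2 + 1) + (1 + (n * 2 + 3))

read-order-rule : ∀ n {w o} → Triple read-order (read-cost n)
  ⟨ blocks 0 , home , replicate n true ++ false ∷ w , o ⟩ ⟨ blocks n , home , w , o ⟩
read-order-rule n {w} {o} = pre start (post (same (λ c → cong (λ n → blocks n c) (toℕ-fromℕ n))
      (λ c → cong (λ n → standing (+ n) c) (toℕ-fromℕ n)) (suffix-all {n} (λ _ → [ true ]) (false ∷ w)) refl) reading
  then skip-rule then pre (positions-eq (standing-⊹ n)) (rewind-rule refl refl))
  where
  W : Fin (suc n) → List Bool
  W = suffix (λ _ → [ true ]) (false ∷ w)
  start : ⟨ blocks 0 , home , replicate n true ++ false ∷ w , o ⟩ ≈ ⟨ blocks 0 , standing 0ℤ , W zero , o ⟩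
  start = same (λ _ → refl) (sym ∘ standing-home) (cong (_++ false ∷ w) (replicate-flat n)) refl
  S : Fin (suc n) → State
  S i = ⟨ blocks (toℕ i) , standing (+ toℕ i) , W i , o ⟩
  pop : ∀ i → W (inject₁ i) ≡ true ∷ W (suc i)
  pop = suffix-inject₁ (λ _ → [ true ]) (false ∷ w)
  reading : Triple _ _ (S zero) (S (fromℕ n))
  reading = while-up n S
    (λ { i (rep {t₁ = t₁} _ hi _) → isOne-rule {w = W (suc i)} {t₁} (subst (λ v → In v t₁) (pop i) hi) })
    (λ { (rep {t₁ = t₁} _ hi _) →
      isOne-rule {w = w} {t₁} (subst (λ v → In v t₁) (suffix-all {n} (λ _ → [ true ]) (false ∷ w)) hi) })
    (λ i → pre (same (λ c → cong (λ n → blocks n c) (toℕ-inject₁ i))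
                     (λ c → cong (λ n → standing (+ n) c) (toℕ-inject₁ i)) (pop i) refl)
      (instr-rule read-order-instruction nothing (λ _ _ _ _ → refl) silent dropped (local-ok (toℕ i))))
    where
    local-ok : ∀ i c {t} → Ones (blocks i c) (standing (+ i) c) t →
      Ones (blocks (suc i) c) (standing (+ suc i) c) (act (Instruction.local read-order-instruction c (scan t)) t)
    local-ok i c {t} h with isCounter c
    ... | true  = subst (λ z → Ones (suc i) z (move right (write (just true) t))) (cong +_ (+-comm i 1)) (ones-move right (ones-extend h))
    ... | false = h

erase-cost : ℕ → ℕ
erase-cost n = (n * 2 + 1) + (1 + ((n * 2 + 1) + 1))

erase-rule : ∀ n {w o} → Triple erase-counters (erase-cost n)
  ⟨ blocks n , home , w , o ⟩ ⟨ blocks 0 , home , w , o ⟩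
erase-rule n {w} {o} =
  pre (positions-eq (sym ∘ standing-home))
    (post (positions-eq (λ c → cong (λ n → standing (+ n) c) (toℕ-fromℕ n))) forward then
     post (positions-eq (standing-move left (+ n))) shift-rule then
     backward then
     post (positions-eq (λ c → trans (standing-move right -1ℤ c) (standing-home c))) shift-rule)
  where
  S : Fin (suc n) → State
  S i = ⟨ blocks n , standing (+ toℕ i) , w , o ⟩
  forward : Triple _ _ (S zero) (S (fromℕ n))
  forward = while-up n S
    (λ i → at-holds counter-u (cong is-just (ones-< (subst (_< n) (sym (toℕ-inject₁ i)) (toℕ<n i)))))
    (at-holds counter-u (cong is-just (trans (cong (λ i → ones n (+ i)) (toℕ-fromℕ n)) (ones-≡ n))))
    (λ i → post (positions-eq λ c → trans (standing-move right (+ toℕ (inject₁ i)) c)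
        (cong (λ i → standing (+ i) c) (trans (+-comm _ 1) (cong suc (toℕ-inject₁ i))))) shift-rule)
  R : ℕ → State
  -- The heads stand on the last of the j remaining ones; for j = 0 this is one cell left of home,
  -- which the closing shift corrects.
  R j = ⟨ blocks j , standing (+ j ℤ.+ -1ℤ) , w , o ⟩
  backward : Triple _ _ (R n) (R 0)
  backward = while-down R n
    (λ j _ → at-holds counter-u (cong is-just (ones-< {suc j} ≤-refl)))
    (at-holds counter-u refl)
    (λ j _ → instr-rule erase-instruction nothing (λ _ _ _ _ → refl) silent kept (local-ok j))
    where
    local-ok : ∀ j c {t} → Ones (blocks (suc j) c) (standing (+ j) c) t →
      Ones (blocks j c) (standing (+ j ℤ.+ -1ℤ) c) (act (Instruction.local erase-instruction c (scan t)) t)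
    local-ok j c h with isCounter c
    ... | true  = ones-move left (ones-shrink h)
    ... | false = h

expand-cost : ℕ → ℕ
expand-cost n = read-cost n + (header-cost n + (rows-cost n + erase-cost n))

expand-one-rule : ∀ {n} (G : Graph n) {w o} → Triple expand-one (expand-cost n)
  ⟨ blocks 0 , home , encodeGraph G ++ w , o ⟩ ⟨ blocks 0 , home , w , o ++ encodeGraph (expand G) ⟩
expand-one-rule {n} G {w} {o} =
  pre (same (λ _ → refl) (λ _ → refl)
         (trans (cong (_++ w) (encode-flat G)) (++-assoc (replicate n true) _ w)) refl)
  (post (same (λ _ → refl) (λ _ → refl) refl
         (trans (++-assoc o (header-output n) (rows-output G)) (cong (o ++_) (sym (encode-expand G)))))
  (read-order-rule n then header-rule n then rows-rule G then erase-rule n))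

-- Copying the input and rewinding the tapes

nonblank₀ nonblank₁ : Symbols → Bool
nonblank₀ (s ∷ _)     = is-just s
nonblank₁ (_ ∷ s ∷ _) = is-just s

left₀ right₀ left₁ right₀₁ copy₀₁ start-action : Symbols → Actions
left₀ (s ∷ ss)        = (s , left) ∷ still ss
right₀ (s ∷ ss)       = (s , right) ∷ still ss
left₁ (s ∷ s′ ∷ ss)   = (s , stay) ∷ (s′ , left) ∷ still ss
right₀₁ (s ∷ s′ ∷ ss) = (s , right) ∷ (s′ , right) ∷ still ss
copy₀₁ (s ∷ _ ∷ ss)   = (s , right) ∷ (s , right) ∷ still ss
-- The second tape steps right so that a listed blank precedes the copy; the three tapes that are
-- not counters receive their mark.
start-action (s ∷ s′ ∷ ss) = (s , stay) ∷ (s′ , right) ∷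
  Vec.tabulate (λ c → (if isCounter c then lookup ss c else just true) , stay)

prepare finish expand-both : Prog
-- Input and output share the first tape of a machine, so the input is copied. `right₀₁` then leaves
-- a blank between the old input and the output, and puts the second head at the start of the copy.
prepare = op start-action ⨾ while nonblank₀ (op copy₀₁) ⨾
          (op left₁ ⨾ while nonblank₁ (op left₁)) ⨾ op right₀₁
finish = (op left₀ ⨾ while nonblank₀ (op left₀)) ⨾ op right₀
expand-both = prepare ⨾ (expand-one ⨾ expand-one) ⨾ finish

written : List Bool → List Symbol → Tape
written w ls = tape (map just w ʳ++ (blank ∷ ls)) blank []

facing : List Symbol → List Bool → Tape
facing ls []      = tape ls blank []
facing ls (b ∷ w) = tape ls (just b) (map just w)

fromCells-facing : ∀ w → fromCells (map just w) ≡ facing [] w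
fromCells-facing []      = refl
fromCells-facing (b ∷ w) = refl

facing-right : ∀ ls b w → move right (facing ls (b ∷ w)) ≡ facing (just b ∷ ls) w
facing-right ls b []      = refl
facing-right ls b (_ ∷ w) = refl

copy-exec : ∀ w ls₀ ls₁ ts → Exec (while nonblank₀ (op copy₀₁))
  (facing ls₀ w ∷ tape ls₁ blank [] ∷ ts) (length w * 2 + 1)
  (tape (map just w ʳ++ ls₀) blank [] ∷ tape (map just w ʳ++ ls₁) blank [] ∷ ts)
copy-exec []      ls₀ ls₁ ts = exec-done refl
copy-exec (b ∷ w) ls₀ ls₁ ts = exec-again refl
  (subst (Exec _ _ 1) (cong₂ (λ t ts → t ∷ tape (just b ∷ ls₁) blank [] ∷ ts) (facing-right ls₀ b w) (perform-still ts)) exec-op)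
  (copy-exec w (just b ∷ ls₀) (just b ∷ ls₁) ts)

-- The tape to be rewound sits at one place of the configuration C.
module Rewinding (C : Tape → Tapes) (test : Symbols → Bool) (f : Symbols → Actions)
  (test-C : ∀ t → test (scans (C t)) ≡ is-just (scan t))
  (f-C    : ∀ t → perform (f (scans (C t))) (C t) ≡ C (move left t)) where

  back : ∀ v ls s rs → Exec (while test (op f))
    (C (move left (tape (map just v ++ blank ∷ ls) s rs))) (length v * 2 + 1)
    (C (tape ls blank (map just v ʳ++ (s ∷ rs))))
  back []      ls s rs = exec-done (test-C _)
  back (b ∷ v) ls s rs = exec-again (test-C _)
    (subst (Exec _ _ 1) (f-C _) exec-op) (back v ls (just b) (s ∷ rs))

  rewind-exec : ∀ w ls → Exec (op f ⨾ while test (op f)) (C (written w ls)) (length w * 2 + 2)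
    (C (tape ls blank (map just w ++ [ blank ])))
  rewind-exec w ls = subst₂ (λ t t′ → Exec (op f ⨾ while test (op f)) (C t) (length w * 2 + 2) (C t′)) t-eq t′-eq
    (exec-weaken (≤-reflexive lem)
      (exec-seq (subst (Exec (op f) _ 1) (f-C _) exec-op) (back (reverse w) ls blank [])))
    where
    lem : 1 + (length (reverse w) * 2 + 1) ≡ length w * 2 + 2
    lem rewrite length-reverse w = trans (+-comm 1 _) (+-assoc (length w * 2) 1 1)
    t-eq : tape (map just (reverse w) ++ blank ∷ ls) blank [] ≡ written w ls
    t-eq = cong (λ l → tape l blank []) (trans (cong (_++ blank ∷ ls) (reverse-map just w)) (sym (ʳ++-defn (map just w))))
    t′-eq : tape ls blank (map just (reverse w) ʳ++ [ blank ]) ≡ tape ls blank (map just w ++ [ blank ])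
    t′-eq = cong (tape ls blank) (trans (cong (_ʳ++ [ blank ]) (reverse-map just w))
      (trans (ʳ++-defn (reverse (map just w))) (cong (_++ [ blank ]) (reverse-involutive (map just w)))))

step-right : ∀ w ls → In w (move right (tape ls blank (map just w ++ [ blank ])))
step-right []      ls = refl
step-right (b ∷ w) ls = refl

output-In : ∀ M q w t ts → In w t → TM.output M (q , t ∷ ts) ≡ w
output-In M q []      (tape ls s rs)       ts refl = refl
output-In M q (b ∷ w) (tape ls s (r ∷ rs)) ts h with refl ← ∷-injectiveˡ h =
  cong (b ∷_) (output-In M q w (tape ls r rs) ts (∷-injectiveʳ h))
output-In M q (b ∷ []) (tape ls s []) ts ()
output-In M q (b ∷ _ ∷ w) (tape ls s []) ts ()

total-cost : ℕ → ℕ → ℕ → ℕ → ℕ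
total-cost l n m l′ =
  (1 + ((l * 2 + 1) + ((l * 2 + 2) + 1))) + ((expand-cost n + expand-cost m) + ((l′ * 2 + 2) + 1))

blank-tapes : Vec Tape 7
blank-tapes = Vec.replicate 7 (fromCells [])

blank-tapes-blocks : Blocks (λ _ → 0) home blank-tapes
blank-tapes-blocks c y rewrite lookup-replicate c (fromCells []) = trans (blank-read y) (sym (ones-0 (y ℤ.+ 0ℤ)))
  where
  blank-read : ∀ y → read (fromCells []) y ≡ blank
  blank-read (+ zero)  = refl
  blank-read (+ suc i) = refl
  blank-read -[1+ i ]  = refl
  ones-0 : ∀ z → ones 0 z ≡ blank
  ones-0 (+ i)    = refl
  ones-0 -[1+ i ] = refl

graphs-rule : ∀ {n m} (G : Graph n) (H : Graph m) →
  Triple (expand-one ⨾ expand-one) (expand-cost n + expand-cost m)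
    ⟨ blocks 0 , home , encodeGraph G ++ encodeGraph H , [] ⟩
    ⟨ blocks 0 , home , [] , encodeGraph (expand G) ++ encodeGraph (expand H) ⟩
graphs-rule G H = expand-one-rule G then
  pre (same (λ _ → refl) (λ _ → refl) (sym (++-identityʳ (encodeGraph H))) refl) (expand-one-rule H)

local-start : Fin 7 → Symbol → Symbol × Move
local-start c s = (if isCounter c then s else just true) , stay

marks : Vec Tape 7
marks = Vec.zipWith act (Vec.tabulate (λ c → local-start c (lookup (Vec.map scan blank-tapes) c))) blank-tapes

marks-blocks : Blocks (blocks 0) home marks
marks-blocks = perform-local local-start {blank-tapes} ok blank-tapes-blocks
  where
  ok : ∀ c {t} → Ones 0 0ℤ t → Ones (blocks 0 c) 0ℤ (act (local-start c (scan t)) t)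
  ok c h with isCounter c
  ... | true  = h
  ... | false = ones-extend h

module _ (w : List Bool) where

  consumed copied : Tape
  consumed = tape (map just w ʳ++ []) blank []
  copied   = tape [] blank (map just w ++ [ blank ])

  start-exec : Exec (op start-action) (fromCells (map just w) ∷ Vec.replicate 8 (fromCells [])) 1
                    (facing [] w ∷ tape [ blank ] blank [] ∷ marks)
  start-exec = subst (λ t → Exec (op start-action) (fromCells (map just w) ∷ Vec.replicate 8 (fromCells [])) 1
                        (t ∷ tape [ blank ] blank [] ∷ marks)) (fromCells-facing w) exec-op

  leave-exec : Exec (op right₀₁) (consumed ∷ copied ∷ marks) 1 (move right consumed ∷ move right copied ∷ marks)
  leave-exec = subst (Exec (op right₀₁) (consumed ∷ copied ∷ marks) 1)
    (cong (λ ts → move right consumed ∷ move right copied ∷ ts) (perform-still marks)) exec-op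

  rewind-copy-exec : Exec (op left₁ ⨾ while nonblank₁ (op left₁)) (consumed ∷ written w [] ∷ marks)
                       (length w * 2 + 2) (consumed ∷ copied ∷ marks)
  rewind-copy-exec = Rewinding.rewind-exec (λ t → consumed ∷ t ∷ marks) nonblank₁ left₁ (λ _ → refl)
    (λ t → cong (λ ts → consumed ∷ move left t ∷ ts) (perform-still marks)) w []

  prepare-exec : ∃[ ts ] Exec prepare (fromCells (map just w) ∷ Vec.replicate 8 (fromCells []))
                   (1 + ((length w * 2 + 1) + ((length w * 2 + 2) + 1))) ts
                 × Rep ⟨ blocks 0 , home , w , [] ⟩ ts
  prepare-exec = _ ,
    exec-seq {b = 1} {c = (length w * 2 + 1) + ((length w * 2 + 2) + 1)} start-exec
      (exec-seq {b = length w * 2 + 1} {c = (length w * 2 + 2) + 1} (copy-exec w [] [ blank ] marks)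
        (exec-seq {b = length w * 2 + 2} {c = 1} rewind-copy-exec leave-exec)) ,
    rep (map just w ʳ++ [] , refl) (step-right w []) marks-blocks

finish-exec : ∀ {ms zs v w ts} → Rep ⟨ ms , zs , v , w ⟩ ts →
  ∃[ t ] ∃[ ts′ ] Exec finish ts ((length w * 2 + 2) + 1) (t ∷ ts′) × In w t
finish-exec {w = w} (rep {t₁ = t₁} {ts} (ls , refl) _ _) = _ , _ ,
  exec-seq (Rewinding.rewind-exec (λ t → t ∷ t₁ ∷ ts) nonblank₀ left₀ (λ _ → refl)
      (λ t → cong (λ ts → move left t ∷ t₁ ∷ ts) (perform-still ts)) w ls)
    exec-op ,
  step-right w ls

expand-both-computes : ∀ {n m} (G : Graph n) (H : Graph m) →
  let w  = encodeGraph G ++ encodeGraph H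
      w′ = encodeGraph (expand G) ++ encodeGraph (expand H)
  in TM.ComputesIn (machine expand-both) (total-cost (length w) n m (length w′)) w w′
expand-both-computes G H =
  let w′ = encodeGraph (expand G) ++ encodeGraph (expand H)
      _ , prepared , R = prepare-exec (encodeGraph G ++ encodeGraph H)
      _ , expanded , R′ = graphs-rule G H R
      t , ts , finished , out = finish-exec R′
      steps , bound , run = exec-seq prepared (exec-seq expanded finished)
  in steps , (zero , t ∷ ts) , bound , run-machine run , output-In (machine expand-both) zero w′ t ts out

-- The polynomial time bound

code-length : ℕ → ℕ
code-length n = n + suc (n * n)

length-flat : ∀ {n} {e : Fin n → List Bool} {c} → (∀ i → length (e i) ≡ c) → length (flat e) ≡ n * c
length-flat {zero}          h = refl
length-flat {suc n} {e} {c} h = trans (length-++ (e zero)) (cong₂ _+_ (h zero) (length-flat (h ∘ suc)))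

length-encode : ∀ {n} (G : Graph n) → length (encodeGraph G) ≡ code-length n
length-encode {n} G = trans (cong length (encode-flat G))
  (trans (length-++ (replicate n true)) (cong₂ _+_ (length-replicate n) (cong suc
    (length-flat {n} λ u → trans (length-flat {n} {λ v → [ adj G u v ]} (λ _ → refl)) (*-identityʳ n)))))

length-encode₂ : ∀ {n m} (G : Graph n) (H : Graph m) →
                 length (encodeGraph G ++ encodeGraph H) ≡ code-length n + code-length m
length-encode₂ G H = trans (length-++ (encodeGraph G)) (cong₂ _+_ (length-encode G) (length-encode H))

-- Since 2 ≤ l, a sum of two powers is absorbed by one further power, so bounds by pure powers of l
-- are closed under sums and products without any coefficients.
module PolynomialBounds {I : Set} (l : I → ℕ) (2≤l : ∀ i → 2 ≤ l i) where

  Bounded : (I → ℕ) → Set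
  Bounded f = ∃[ d ] ∀ i → f i ≤ l i ^ d

  ^-mono : ∀ i {d e} → d ≤ e → l i ^ d ≤ l i ^ e
  ^-mono i = ^-monoʳ-≤ (l i) {{ℕ.>-nonZero (≤-trans (s≤s z≤n) (2≤l i))}}

  double : ∀ i d → l i ^ d + l i ^ d ≤ l i ^ suc d
  double i d = ≤-trans (≤-reflexive (cong (_+_ (l i ^ d)) (sym (+-identityʳ _)))) (*-monoˡ-≤ (l i ^ d) (2≤l i))

  below : ∀ {f} → (∀ i → f i ≤ l i) → Bounded f
  below h = 1 , λ i → ≤-trans (h i) (≤-reflexive (sym (^-identityʳ (l i))))

  const : ∀ c → Bounded (λ _ → c)
  const c = c , bound c
    where
    bound : ∀ c i → c ≤ l i ^ c
    bound zero    i = z≤n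
    bound (suc c) i = ≤-trans (+-mono-≤ (^-mono i {0} {c} z≤n) (bound c i)) (double i c)

  infixl 6 _⊕_
  infixl 7 _⊛_

  _⊕_ : ∀ {f g} → Bounded f → Bounded g → Bounded (λ i → f i + g i)
  (d , p) ⊕ (e , q) = suc (d + e) , λ i →
    ≤-trans (+-mono-≤ (≤-trans (p i) (^-mono i (m≤m+n d e))) (≤-trans (q i) (^-mono i (m≤n+m e d))))
      (double i (d + e))

  _⊛_ : ∀ {f g} → Bounded f → Bounded g → Bounded (λ i → f i * g i)
  (d , p) ⊛ (e , q) = d + e , λ i →
    ≤-trans (*-mono-≤ (p i) (q i)) (≤-reflexive (sym (^-distribˡ-+-* (l i) d e)))

  one : Bounded (λ _ → 1)
  one = const 1

  module _ {n : I → ℕ} (N : Bounded n) where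

    twice : ∀ c → Bounded (λ i → n i * 2 + c)
    twice c = N ⊛ const 2 ⊕ const c

    bounded-for : ∀ {b} → Bounded b → Bounded (λ i → for-cost (b i) (n i))
    bounded-for B = N ⊛ (B ⊕ const 4) ⊕ const 4

    bounded-for² : Bounded (λ i → for²-cost (n i))
    bounded-for² = bounded-for (one ⊕ bounded-for one)

    bounded-expand : Bounded (λ i → expand-cost (n i))
    bounded-expand = (twice 1 ⊕ (one ⊕ twice 3)) ⊕ ((bounded-for² ⊕ one) ⊕
      (bounded-for (bounded-for² ⊕ bounded-for (bounded-for² ⊕ one)) ⊕ (twice 1 ⊕ (one ⊕ (twice 1 ⊕ one)))))

    bounded-code-length : Bounded (λ i → code-length (n i * suc (n i)))
    bounded-code-length = M ⊕ (one ⊕ M ⊛ M)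
      where M = N ⊛ (one ⊕ N)

total-bound : ∃[ d ] ∀ (x : Instance GI) → let ((n , G) , (m , H)) = x ; l = length (encode GI x) in
  total-cost l n m (length (encodeGraph (expand G) ++ encodeGraph (expand H))) ≤ l ^ d + d
total-bound = proj₁ total , λ { x@((n , G) , (m , H)) →
    ≤-trans (≤-reflexive (cong (total-cost (length (encode GI x)) n m) (length-encode₂ (expand G) (expand H))))
      (≤-trans (proj₂ total x) (m≤m+n _ _)) }
  where
  l n m : Instance GI → ℕ
  l x = length (encode GI x)
  n x = proj₁ (proj₁ x)
  m x = proj₁ (proj₂ x)
  l≡ : ∀ x → l x ≡ code-length (n x) + code-length (m x)
  l≡ ((_ , G) , (_ , H)) = length-encode₂ G H
  -- Every code contains its terminating 0, so two codes have length at least 2 even for empty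
  -- graphs.
  positive : ∀ n → 1 ≤ code-length n
  positive n = ≤-trans (s≤s z≤n) (m≤n+m (suc (n * n)) n)
  2≤l : ∀ x → 2 ≤ l x
  2≤l x = subst (2 ≤_) (sym (l≡ x)) (+-mono-≤ (positive (n x)) (positive (m x)))
  open PolynomialBounds l 2≤l
  L : Bounded l
  L = below (λ _ → ≤-refl)
  N : Bounded n
  N = below λ x → subst (n x ≤_) (sym (l≡ x)) (≤-trans (m≤m+n (n x) _) (m≤m+n (code-length (n x)) _))
  M : Bounded m
  M = below λ x → subst (m x ≤_) (sym (l≡ x)) (≤-trans (m≤m+n (m x) _) (m≤n+m _ (code-length (n x))))
  total : Bounded (λ x → total-cost (l x) (n x) (m x) (code-length (n x * suc (n x)) + code-length (m x * suc (m x))))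
  total = (one ⊕ (twice L 1 ⊕ (twice L 2 ⊕ one))) ⊕ ((bounded-expand N ⊕ bounded-expand M) ⊕
    (twice (bounded-code-length N ⊕ bounded-code-length M) 2 ⊕ one))

expand₂ : Instance GI → Instance GI
expand₂ ((_ , G) , (_ , H)) = (_ , expand G) , (_ , expand H)

expand₂-polyTime : ∃[ M ] ∃[ d ] ∀ x → let w = encode GI x in
  TM.ComputesIn M (length w ^ d + d) w (encode GI (expand₂ x))
expand₂-polyTime = machine expand-both , proj₁ total-bound , λ { x@((_ , G) , (_ , H)) →
  let t , c , bound , run , out = expand-both-computes G H
  in t , c , ≤-trans bound (proj₂ total-bound x) , run , out }

-- Thickness and isomorphism of expanded graphs

index : ∀ {n} → Vertex n → Fin (n * suc n)
index (u , i) = combine u i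

vertex : ∀ {n} → Fin (n * suc n) → Vertex n
vertex {n} = remQuot (suc n)

vertex-index : ∀ {n} (x : Vertex n) → vertex (index x) ≡ x
vertex-index (u , i) = remQuot-combine u i

index-vertex : ∀ {n} (x : Fin (n * suc n)) → index (vertex {n} x) ≡ x
index-vertex {n} = combine-remQuot {n} (suc n)

module Parts {n : ℕ} (G : Graph n) (k : ℕ) where

  Part : Set
  Part = Fin (suc (suc k))

  -- Part 0 consists of the stars at the hubs. In part 1 each link is a star with one leaf, namely
  -- its end with u < a. All further parts are edgeless.
  leaf : Part → Vertex n → Bool
  leaf _          (u , zero)  = false
  leaf zero       (u , suc a) = true
  leaf (suc zero) (u , suc a) = does (u <? a) ∧ adj G u a
  leaf _          _           = false

  parent : Part → Vertex n → Vertex n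
  parent _          (u , zero)  = u , zero
  parent zero       (u , suc a) = u , zero
  parent (suc _)    (u , suc a) = a , suc u

  parent-root : ∀ i x → leaf i x ≡ true → leaf i (parent i x) ≡ false
  parent-root zero       (u , suc a) h = refl
  parent-root (suc zero) (u , suc a) h =
    cong (_∧ adj G a u) (dec-false (a <? u) (<-asym {x = u} {a}
      (<ᵇ⇒< (toℕ u) (toℕ a) (Equivalence.from T-≡ (∧-conicalˡ _ _ h)))))

  Hangs : Part → Vertex n → Vertex n → Set
  Hangs i x y = leaf i x ≡ true × parent i x ≡ y

  hangs⇒joined : ∀ i {x y} → Hangs i x y → Joined G x y
  hangs⇒joined zero       {u , suc a} (h , refl) = spoke′ u a
  hangs⇒joined (suc zero) {u , suc a} (h , refl) = link (∧-conicalʳ _ _ h)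

  isHub : Vertex n → Bool
  isHub (u , zero)  = true
  isHub (u , suc a) = false

  -- A spoke has exactly one hub among its ends and a link has none.
  colour : Vertex n → Vertex n → Part
  colour x y = if isHub x xor isHub y then zero else suc zero

  colour-sym : ∀ x y → colour x y ≡ colour y x
  colour-sym x y = cong (if_then zero else suc zero) (xor-comm (isHub x) (isHub y))

  hangs⇒colour : ∀ i {x y} → Hangs i x y → colour x y ≡ i
  hangs⇒colour zero       {u , suc a} (h , refl) = refl
  hangs⇒colour (suc zero) {u , suc a} (h , refl) = refl

  joined⇒hangs : ∀ {x y} → Joined G x y → Hangs (colour x y) x y ⊎ Hangs (colour x y) y x
  joined⇒hangs (spoke u a)  = inj₂ (refl , refl)
  joined⇒hangs (spoke′ u a) = inj₁ (refl , refl)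
  joined⇒hangs (link {u} {a} h) with <-cmp u a
  ... | tri< u<a _ _    rewrite dec-true (u <? a) u<a = inj₁ (h , refl)
  ... | tri> _ _ a<u    rewrite dec-true (a <? u) a<u = inj₂ (trans (Graph.sym G a u) h , refl)
  ... | tri≈ _ refl _   = ⊥-elim (no-loop {G = G} h)

  module Stars (i : Part) = Planarity.StarForest
    (index ∘ parent i ∘ vertex) (leaf i ∘ vertex)
    (λ x h → trans (cong (leaf i) (vertex-index (parent i (vertex x)))) (parent-root i (vertex x) h))

  star⇒hangs : ∀ i {x y} → Stars.Hangs i x y → Hangs i (vertex x) (vertex y)
  star⇒hangs i {x} (h , p) = h , trans (sym (vertex-index _)) (cong vertex p)

  hangs⇒star : ∀ i {x y} → Hangs i (vertex x) (vertex y) → Stars.Hangs i x y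
  hangs⇒star i {y = y} (h , p) = h , trans (cong index p) (index-vertex {n} y)

  part : Part → Graph (n * suc n)
  part = Stars.forest

  part-adj : ∀ i x y → Adj (part i) x y → Hangs i (vertex x) (vertex y) ⊎ Hangs i (vertex y) (vertex x)
  part-adj i x y = ⊎-map (star⇒hangs i) (star⇒hangs i) ∘ Stars.adj⇒Hangs i x y

  expand-thickness : Thickness≤ (suc (suc k)) (expand G)
  expand-thickness = record
    { part        = part
    ; part-planar = Stars.forest-planar
    ; part-sub    = λ i x y h → joined⇒linked
        ([ hangs⇒joined i , joined-sym ∘ hangs⇒joined i ]′ (part-adj i x y h))
    ; part-cover  = λ x y h → let c = colour (vertex x) (vertex y) in
        c ,
        Stars.Hangs⇒adj c (⊎-map (hangs⇒star c) (hangs⇒star c) (joined⇒hangs (linked⇒joined G (vertex x) (vertex y) h))) ,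
        λ {i} h → [ hangs⇒colour i , trans (colour-sym (vertex x) (vertex y)) ∘ hangs⇒colour i ]′ (part-adj i x y h)
    }

-- Isomorphic expansions come from isomorphic graphs, and conversely

record Iso {A B : Set} (R : A → A → Set) (S : B → B → Set) : Set where
  field
    to        : A → B
    from      : B → A
    from-to   : ∀ x → from (to x) ≡ x
    to-from   : ∀ y → to (from y) ≡ y
    to-pres   : ∀ {x y} → R x y → S (to x) (to y)
    from-pres : ∀ {x y} → S x y → R (from x) (from y)

iso-sym : ∀ {A B} {R : A → A → Set} {S : B → B → Set} → Iso R S → Iso S R
iso-sym f = record
  { to = from ; from = to ; from-to = to-from ; to-from = from-to
  ; to-pres = from-pres ; from-pres = to-pres }
  where open Iso f

iso-trans : ∀ {A B C} {R : A → A → Set} {S : B → B → Set} {T : C → C → Set} →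
            Iso R S → Iso S T → Iso R T
iso-trans f g = record
  { to        = G.to ∘ F.to
  ; from      = F.from ∘ G.from
  ; from-to   = λ x → trans (cong F.from (G.from-to (F.to x))) (F.from-to x)
  ; to-from   = λ y → trans (cong G.to (F.to-from (G.from y))) (G.to-from y)
  ; to-pres   = G.to-pres ∘ F.to-pres
  ; from-pres = F.from-pres ∘ G.from-pres
  }
  where
  module F = Iso f
  module G = Iso g

≅⇒iso : ∀ {m n} {G : Graph m} {H : Graph n} → G ≅ H → Iso (Adj G) (Adj H)
≅⇒iso {H = H} (φ , pres) = record
  { to        = to
  ; from      = from
  ; from-to   = strictlyInverseʳ
  ; to-from   = strictlyInverseˡ
  ; to-pres   = Equivalence.to (pres _ _)
  ; from-pres = λ {x} {y} h → Equivalence.from (pres _ _)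
      (subst₂ (Adj H) (sym (strictlyInverseˡ x)) (sym (strictlyInverseˡ y)) h)
  }
  where open Inverse (⤖⇒↔ φ)

iso⇒≅ : ∀ {m n} {G : Graph m} {H : Graph n} → Iso (Adj G) (Adj H) → G ≅ H
iso⇒≅ {G = G} f = ↔⇒⤖ (mk↔ₛ′ to from to-from from-to) , λ u v →
  mk⇔ to-pres (subst₂ (Adj G) (from-to u) (from-to v) ∘ from-pres)
  where open Iso f

-- Passes from indices to pairs, where `Joined` allows case analysis on the kind of edge.
expand-vertices : ∀ {n} (G : Graph n) → Iso (Joined G) (Adj (expand G))
expand-vertices {n} G = record
  { to        = index
  ; from      = vertex
  ; from-to   = vertex-index
  ; to-from   = index-vertex {n}
  ; to-pres   = λ {x} {y} h → joined⇒linked (subst₂ (Joined G) (sym (vertex-index x)) (sym (vertex-index y)) h)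
  ; from-pres = λ {x} {y} → linked⇒joined G (vertex x) (vertex y)
  }

lift : ∀ {m n} → (Fin m → Fin n) → Vertex m → Vertex n
lift f (u , zero)  = f u , zero
lift f (u , suc a) = f u , suc (f a)

lift-inverse : ∀ {m n} {f : Fin m → Fin n} {g : Fin n → Fin m} → (∀ u → g (f u) ≡ u) →
               ∀ x → lift g (lift f x) ≡ x
lift-inverse h (u , zero)  = cong (_, zero) (h u)
lift-inverse h (u , suc a) = cong₂ (λ u a → u , suc a) (h u) (h a)

lift-joined : ∀ {m n} {G : Graph m} {H : Graph n} {f} → (∀ {u v} → Adj G u v → Adj H (f u) (f v)) →
              ∀ {x y} → Joined G x y → Joined H (lift f x) (lift f y)
lift-joined h (spoke u a)  = spoke _ _
lift-joined h (spoke′ u a) = spoke′ _ _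
lift-joined h (link e)     = link (h e)

joined-iso : ∀ {m n} {G : Graph m} {H : Graph n} → Iso (Adj G) (Adj H) → Iso (Joined G) (Joined H)
joined-iso f = record
  { to = lift to ; from = lift from
  ; from-to = lift-inverse from-to ; to-from = lift-inverse to-from
  ; to-pres = lift-joined to-pres ; from-pres = lift-joined from-pres
  }
  where open Iso f

-- With at least two vertices, hubs are recognised by having a leaf among two or
-- more neighbours: the half-edge (u , 1 + u) is such a leaf, as u is no loop.
Hub : {A : Set} → (A → A → Set) → A → Set
Hub R x = ∃[ y ] ∃[ z ] y ≢ z × R x y × R x z × (∀ {w} → R y w → w ≡ x)

hub-iso : ∀ {A B} {R : A → A → Set} {S : B → B → Set} (f : Iso R S) →
          ∀ {x} → Hub R x → Hub S (Iso.to f x)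
hub-iso {R = R} {S} f {x} (y , z , y≢z , xy , xz , only) =
  to y , to z , (λ eq → y≢z (trans (sym (from-to y)) (trans (cong from eq) (from-to z)))) ,
  to-pres xy , to-pres xz ,
  λ {w} yw → trans (sym (to-from w)) (cong to (only (subst (λ y → R y (from w)) (from-to y) (from-pres yw))))
  where open Iso f

module _ {n : ℕ} {G : Graph n} where

  hub-intro : ∀ {a b : Fin n} → a ≢ b → ∀ u → Hub (Joined G) (u , zero)
  hub-intro {a} {b} a≢b u = (u , suc u) , (u , suc other) , (λ eq → other≢ (suc-injective (cong proj₂ eq))) ,
    spoke u u , spoke u other , λ { (spoke′ _ _) → refl ; (link h) → ⊥-elim (no-loop {G = G} h) }
    where
    pick : ∃[ v ] u ≢ v
    pick with u ≟ a
    ... | yes refl = b , a≢b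
    ... | no u≢a   = a , u≢a
    other = proj₁ pick
    other≢ : u ≢ other
    other≢ = proj₂ pick

  -- Suppose (u , 1 + a) qualified. If `y` is its hub, the neighbour (u , 1 + u) of `y` forces a =
  -- u, and then a second neighbour would give a loop. If `y` is its link partner, the hub of `y` is
  -- a further neighbour.
  hub-elim : ∀ {x} → Hub (Joined G) x → ∃[ u ] x ≡ (u , zero)
  hub-elim {u , zero} _ = u , refl
  hub-elim {u , suc a} (_ , z , y≢z , spoke′ _ _ , xz , only) with refl ← only (spoke u u) with xz
  ... | spoke′ _ _ = ⊥-elim (y≢z refl)
  ... | link h     = ⊥-elim (no-loop {G = G} h)
  hub-elim {u , suc a} (_ , z , y≢z , link h , xz , only) with () ← only (spoke′ a u)

  -- Carries the existence of two vertices across an isomorphism: a transported hub has two distinct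
  -- leaves.
  hub-two : ∀ {x} → Hub (Joined G) x → ∃[ a ] ∃[ b ] _≢_ {A = Fin n} a b
  hub-two h@(_ , _ , y≢z , xy , xz , _) with u , refl ← hub-elim h with xy | xz
  ... | spoke _ a | spoke _ b = a , b , λ { refl → y≢z refl }

  -- If the middle step went back to the hub, the last one would join two hubs; hence it is a link,
  -- and the spokes fix its ends.
  path-elim : ∀ {u v x y} → Joined G (u , zero) x → Joined G x y → Joined G y (v , zero) → Adj G u v
  path-elim (spoke u a) (link h) (spoke′ _ _) = h

contract-main : ∀ {m n} {G : Graph m} {H : Graph n} {a b : Fin m} → a ≢ b →
                Iso (Joined G) (Joined H) → Iso (Adj G) (Adj H)
contract-main {m} {n} {G} {H} {a} a≢b f = record
  { to        = proj₁ ∘ image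
  ; from      = proj₁ ∘ preimage
  ; from-to   = λ u → cong proj₁ (trans (sym (proj₂ (preimage _)))
                  (trans (cong from (sym (proj₂ (image u)))) (from-to (u , zero))))
  ; to-from   = λ v → cong proj₁ (trans (sym (proj₂ (image _)))
                  (trans (cong to (sym (proj₂ (preimage v)))) (to-from (v , zero))))
  ; to-pres   = λ {u} {v} h → path-elim {G = H}
      (subst (λ x → Joined H x (to (u , suc v))) (proj₂ (image u)) (to-pres (spoke u v)))
      (to-pres (link h))
      (subst (Joined H (to (v , suc u))) (proj₂ (image v)) (to-pres (spoke′ v u)))
  ; from-pres = λ {u} {v} h → path-elim {G = G}
      (subst (λ x → Joined G x (from (u , suc v))) (proj₂ (preimage u)) (from-pres (spoke u v)))
      (from-pres (link h))
      (subst (Joined G (from (v , suc u))) (proj₂ (preimage v)) (from-pres (spoke′ v u)))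
  }
  where
  open Iso f
  image : ∀ u → ∃[ v ] to (u , zero) ≡ (v , zero)
  image u = hub-elim {G = H} (hub-iso f (hub-intro {G = G} a≢b u))
  c≢d = proj₂ (proj₂ (hub-two {G = H} (hub-iso f (hub-intro {G = G} a≢b a))))
  preimage : ∀ v → ∃[ u ] from (v , zero) ≡ (u , zero)
  preimage v = hub-elim {G = G} (hub-iso (iso-sym f) (hub-intro {G = H} c≢d v))

-- Two vertices on either side suffice, by symmetry. Orders 0 and 1 cannot be mixed, as only the
-- empty graph has an empty expansion, and two graphs of order 1 have no edges to compare.
contract : ∀ {m n} {G : Graph m} {H : Graph n} → Iso (Joined G) (Joined H) → Iso (Adj G) (Adj H)
contract {suc (suc m)} f = contract-main {a = zero} {suc zero} (λ ()) f
contract {zero}  {suc (suc n)} f = iso-sym (contract-main {a = zero} {suc zero} (λ ()) (iso-sym f))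
contract {suc zero} {suc (suc n)} f = iso-sym (contract-main {a = zero} {suc zero} (λ ()) (iso-sym f))
contract {zero} {suc zero} f = case proj₁ (Iso.from f (zero , zero)) of λ ()
contract {suc zero} {zero} f = case proj₁ (Iso.to f (zero , zero)) of λ ()
contract {zero} {zero} f = record
  { to = λ () ; from = λ () ; from-to = λ () ; to-from = λ () ; to-pres = λ { {()} } ; from-pres = λ { {()} } }
contract {suc zero} {suc zero} {G} {H} f = record
  { to = id ; from = id ; from-to = λ _ → refl ; to-from = λ _ → refl
  ; to-pres   = λ { {zero} {zero} h → ⊥-elim (no-loop {G = G} h) }
  ; from-pres = λ { {zero} {zero} h → ⊥-elim (no-loop {G = H} h) }
  }

expand-≅ : ∀ {m n} (G : Graph m) (H : Graph n) → G ≅ H ⇔ expand G ≅ expand H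
expand-≅ G H = mk⇔
  (λ φ → iso⇒≅ {G = expand G} {expand H} (iso-trans (iso-sym (expand-vertices G))
           (iso-trans (joined-iso (≅⇒iso {G = G} {H} φ)) (expand-vertices H))))
  (λ ψ → iso⇒≅ {G = G} {H} (contract (iso-trans (expand-vertices G)
           (iso-trans (≅⇒iso {G = expand G} {expand H} ψ) (iso-sym (expand-vertices H))))))

-- The two reductions

halted : TM
halted = record { workTapes = 0 ; states = 1 ; start = zero ; δ = λ _ _ → nothing }

output-facing : ∀ M q w ls ts → TM.output M (q , facing ls w ∷ ts) ≡ w
output-facing M q []           ls ts = refl
output-facing M q (b ∷ [])     ls ts = refl
output-facing M q (b ∷ b′ ∷ w) ls ts = cong (b ∷_) (output-facing M q (b′ ∷ w) ls ts)

-- Forgetting the membership proofs does not change the code, so a machine that halts at once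
-- computes the reduction.
GIOn≤GI : ∀ {C : ∀ {n} → Graph n → Set} → GIOn C ≤ₚ GI
GIOn≤GI = record
  { reduce   = proj₁
  ; polyTime = halted , 0 , λ x → 0 , TM.initial halted (encode GI (proj₁ x)) , z≤n , TM.halt refl ,
      output-initial (encode GI (proj₁ x))
  ; correct  = λ _ → mk⇔ id id
  }
  where
  output-initial : ∀ w → TM.output halted (TM.initial halted w) ≡ w
  output-initial w = trans (cong (λ t → TM.output halted (zero , t ∷ [])) (fromCells-facing w))
    (output-facing halted zero w [] [])

GI≤GIOn : ∀ {C : ∀ {n} → Graph n → Set} → (∀ {n} (G : Graph n) → C (expand G)) → GI ≤ₚ GIOn C
GI≤GIOn C-expand = record
  { reduce   = λ { x@((_ , G) , (_ , H)) → expand₂ x , C-expand G , C-expand H }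
  ; polyTime = expand₂-polyTime
  ; correct  = λ { ((_ , G) , (_ , H)) → expand-≅ G H }
  }

proposition3 : (k : ℕ) → 2 ≤ k → GI-complete (GIOn (Thickness≤ k))
proposition3 (suc (suc k)) (s≤s (s≤s z≤n)) = GIOn≤GI , GI≤GIOn (λ G → Parts.expand-thickness G k)
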